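{- Let $n\ge 1$. For every $[n]$-decorated binary tree $T$ there exists a unique face $\Phi(T)$ of the Catalan arrangement in $\mathbb{R}^n$ consisting of exactly the points $p=(p_1,\dots,p_n)\in\mathbb{R}^n$ satisfying the following three conditions: (1) for all $i,j\in[n]$, $p_i\le p_j$ if and only if $v_T(i)\preceq_T v_T(j)$; (2) for all $i,j\in[n]$, $p_i<p_j+1$ if and only if $v_T(i)\prec_T v^1_T(j)$; (3) for all $i,j\in[n]$, $p_i=p_j+1$ if and only if $v_T(i)=v^1_T(j)$ and $v^1_T(j)$ is a captive node. The map $T\mapsto \Phi(T)$ is a bijection from the set of $[n]$-decorated binary trees to the set of faces of the Catalan arrangement in $\mathbb{R}^n$. Moreover, $T$ has exactly $k$ free nodes if and only if $\Phi(T)$ is a face of dimension $k$.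
   Context: $[n]=\{1,\dots,n\}$. A face of a finite arrangement of affine hyperplanes in $\mathbb{R}^n$ is a nonempty set obtained by choosing, for each hyperplane $\{a\cdot x=c\}$ of the arrangement, one of $a\cdot x<c$, $a\cdot x=c$, $a\cdot x>c$, and taking the solution set of the resulting system; its dimension is the dimension of its affine span. The Catalan arrangement in $\mathbb{R}^n$ consists of the hyperplanes $x_i-x_j=0$ and $x_i-x_j=1$ for distinct $i,j\in[n]$. A binary tree is a rooted plane tree in which every vertex has 0 or 2 children; vertices with no children are leaves, the others are nodes; the first child of a node is its left child, the second its right child, and the corresponding edges are left and right edges. An internal edge is an edge between two nodes. An $[n]$-decorated binary tree is a binary tree in which each node is labeled by a nonempty subset of $[n]$, the labels forming a set partition of $[n]$, and each right internal edge is declared either solid or dashed (all other edges are solid). A captive node is a node joined to its parent by a dashed edge; a free node is a node that is not captive. For a vertex $v$, let $\rho(v)$ be the word in $\{E_0,E_1\}$ recording the path from the root to $v$ ($E_0$ = left edge, $E_1$ = right edge), and $\dot\rho(v)$ the number of right edges on it. For distinct vertices $v,w$, $v\prec_T w$ means: $\dot\rho(v)<\dot\rho(w)$, or $\dot\rho(v)=\dot\rho(w)$ and either $\rho(v)$ is a proper prefix of $\rho(w)$ or at the first position where they differ $\rho(v)$ has $E_1$ and $\rho(w)$ has $E_0$. $v\preceq_T w$ means $v\prec_T w$ or $v=w$. For $i\in[n]$, $v_T(i)$ is the node whose label contains $i$ and $v^1_T(i)$ is the right child of $v_T(i)$.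
   Formalization: Points are taken in Q^n instead of R^n: faces of the Catalan arrangement, the sets Φ(T), and their dimensions (affine independence) are all formed with rational points and rational coefficients. -}

module Defs where

open import Data.Nat using (ℕ; zero; suc) renaming (_+_ to _+ℕ_; _<_ to _<ℕ_)
open import Data.Bool using (Bool; true; false; if_then_else_)
open import Data.Fin using (Fin)
import Data.Nat
open import Data.Fin.Subset using (Subset; ∣_∣)
open import Data.Vec using (lookup)
open import Data.List using (List; []; _∷_; _++_; map; _∷ʳ_)
open import Data.List.Relation.Unary.All using (All)
open import Data.Maybe using (Maybe; just; nothing)
open import Data.Product using (Σ; ∃; _×_; _,_; proj₁; proj₂)
open import Data.Sum using (_⊎_)
open import Relation.Binary.PropositionalEquality using (_≡_; _≢_)
open import Relation.Nullary using (¬_)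
open import Data.Rational using (ℚ; 0ℚ; 1ℚ; _+_; _-_; _*_; _<_; _≤_)
open import Data.Empty using (⊥)

-- Binary trees with node labels and a flag on each right edge
-- node S l d r : label S, left subtree l, right subtree r,
--   d = true  iff the right edge (to r) is dashed.

data BTree (n : ℕ) : Set where
  leaf : BTree n
  node : Subset n → BTree n → Bool → BTree n → BTree n

-- Paths: false = E₀ (left edge), true = E₁ (right edge)
Path : Set
Path = List Bool

nodesOf : ∀ {n} → BTree n → List (Path × Subset n)
nodesOf leaf = []
nodesOf (node S l d r) =
  ([] , S) ∷ (map (λ { (w , X) → (false ∷ w , X) }) (nodesOf l)
           ++ map (λ { (w , X) → (true ∷ w , X) }) (nodesOf r))

subtreeAt : ∀ {n} → BTree n → Path → Maybe (BTree n)
subtreeAt t [] = just t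
subtreeAt leaf (_ ∷ _) = nothing
subtreeAt (node S l d r) (false ∷ w) = subtreeAt l w
subtreeAt (node S l d r) (true ∷ w) = subtreeAt r w

countContaining : ∀ {n} → Fin n → List (Path × Subset n) → ℕ
countContaining i [] = 0
countContaining i ((w , S) ∷ xs) =
  (if lookup S i then 1 else 0) +ℕ countContaining i xs

DashOK : ∀ {n} → BTree n → Set
DashOK leaf = Data.Unit.⊤ where import Data.Unit
DashOK (node S l false r) = DashOK l × DashOK r
DashOK (node S l true leaf) = ⊥
DashOK (node S l true (node S' l' d' r')) = DashOK l × DashOK (node S' l' d' r')

IsDecorated : ∀ {n} → BTree n → Set
IsDecorated {n} t =
  DashOK t
  × All (λ x → 1 Data.Nat.≤ ∣ proj₂ x ∣) (nodesOf t)
  × (∀ (i : Fin n) → countContaining i (nodesOf t) ≡ 1)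

DecTree : ℕ → Set
DecTree n = Σ (BTree n) IsDecorated

-- v_T(i): the path of the (first, hence unique) node whose label contains i
firstContaining : ∀ {n} → Fin n → List (Path × Subset n) → Path
firstContaining i [] = []
firstContaining i ((w , S) ∷ xs) = if lookup S i then w else firstContaining i xs

vT : ∀ {n} → BTree n → Fin n → Path
vT t i = firstContaining i (nodesOf t)

v1T : ∀ {n} → BTree n → Fin n → Path
v1T t i = vT t i ∷ʳ true

Captive : ∀ {n} → BTree n → Path → Set
Captive {n} t w =
  Σ Path λ u → (w ≡ u ∷ʳ true) ×
    (Σ (Subset n) λ S → Σ (BTree n) λ l → Σ (BTree n) λ r →
       subtreeAt t u ≡ just (node S l true r))
  × (Σ (Subset n) λ S → Σ (BTree n) λ l → Σ Bool λ d → Σ (BTree n) λ r →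
       subtreeAt t w ≡ just (node S l d r))

-- number of free (non-captive) nodes; the flag says whether the root is captive
freeNodes' : ∀ {n} → Bool → BTree n → ℕ
freeNodes' c leaf = 0
freeNodes' c (node S l d r) =
  (if c then 0 else 1) +ℕ (freeNodes' false l +ℕ freeNodes' d r)

freeNodes : ∀ {n} → BTree n → ℕ
freeNodes t = freeNodes' false t

rdot : Path → ℕ
rdot [] = 0
rdot (true ∷ w) = suc (rdot w)
rdot (false ∷ w) = rdot w

ProperPrefix : Path → Path → Set
ProperPrefix v w = Σ Bool λ x → Σ Path λ xs → w ≡ v ++ (x ∷ xs)

FirstDiffRightLeft : Path → Path → Set
FirstDiffRightLeft v w =
  Σ Path λ u → Σ Path λ v' → Σ Path λ w' →
    (v ≡ u ++ (true ∷ v')) × (w ≡ u ++ (false ∷ w'))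

_≺_ : Path → Path → Set
v ≺ w = (rdot v <ℕ rdot w)
      ⊎ ((rdot v ≡ rdot w) × (ProperPrefix v w ⊎ FirstDiffRightLeft v w))

_⪯_ : Path → Path → Set
v ⪯ w = (v ≺ w) ⊎ (v ≡ w)

Point : ℕ → Set
Point n = Fin n → ℚ

data Sign : Set where
  neg zer pos : Sign

SignRel : Sign → ℚ → ℚ → Set
SignRel neg x c = x < c
SignRel zer x c = x ≡ c
SignRel pos x c = c < x

-- hyperplanes of the Catalan arrangement: x_i - x_j = c, i ≢ j, c ∈ {0,1}
-- (false ↦ 0, true ↦ 1); a sign assignment chooses a side for each.
const : Bool → ℚ
const false = 0ℚ
const true = 1ℚ

SignAssignment : ℕ → Set
SignAssignment n = (i j : Fin n) → i ≢ j → Bool → Sign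

Sol : ∀ {n} → SignAssignment n → Point n → Set
Sol σ p = ∀ i j (ne : i ≢ j) (k : Bool) → SignRel (σ i j ne k) (p i - p j) (const k)

PointSet : ℕ → Set₁
PointSet n = Point n → Set

IsFace : ∀ {n} → PointSet n → Set
IsFace {n} F = Σ (SignAssignment n) λ σ →
  (Σ (Point n) λ p → Sol σ p) × (∀ p → (F p → Sol σ p) × (Sol σ p → F p))

_≐_ : ∀ {n} → PointSet n → PointSet n → Set
F ≐ G = ∀ p → (F p → G p) × (G p → F p)

sumQ : ∀ {m} → (Fin m → ℚ) → ℚ
sumQ {zero} f = 0ℚ
sumQ {suc m} f = f Fin.zero + sumQ (λ i → f (Fin.suc i))

AffIndep : ∀ {n m} → (Fin (suc m) → Point n) → Set
AffIndep {n} {m} q = ∀ (c : Fin (suc m) → ℚ) →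
  sumQ c ≡ 0ℚ → (∀ (x : Fin n) → sumQ (λ a → c a * q a x) ≡ 0ℚ) → ∀ a → c a ≡ 0ℚ

HasAffIndep : ∀ {n} → PointSet n → ℕ → Set
HasAffIndep {n} F m = Σ (Fin (suc m) → Point n) λ q → (∀ a → F (q a)) × AffIndep q

HasDim : ∀ {n} → PointSet n → ℕ → Set
HasDim F k = HasAffIndep F k × ¬ HasAffIndep F (suc k)

PhiSet : ∀ {n} → BTree n → PointSet n
PhiSet t p = ∀ i j →
    ((p i ≤ p j → vT t i ⪯ vT t j) × (vT t i ⪯ vT t j → p i ≤ p j))
  × ((p i < p j + 1ℚ → vT t i ≺ v1T t j) × (vT t i ≺ v1T t j → p i < p j + 1ℚ))
  × ((p i ≡ p j + 1ℚ → (vT t i ≡ v1T t j) × Captive t (v1T t j))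
     × ((vT t i ≡ v1T t j) × Captive t (v1T t j) → p i ≡ p j + 1ℚ))

{-# OPTIONS --safe #-}
module Submission where

open import Defs
open import Data.Bool using (Bool; true; false; if_then_else_)
import Data.Bool.Properties as Bool
open import Data.Empty using (⊥; ⊥-elim)
open import Data.Fin using (Fin; zero; suc; punchIn; punchOut)
open import Data.Fin.Induction using (spo-wellFounded)
open import Data.Fin.Properties using (any?; punchIn-punchOut) renaming (_≟_ to _≟F_; suc-injective to Fsuc-injective)
open import Data.Fin.Subset using (Subset; ∣_∣)
open import Data.List as List using (List; []; _∷_; _++_; _∷ʳ_; map; length; initLast; _∷ʳ′_)
open import Data.List.Membership.Propositional using (_∈_)
open import Data.List.Membership.Propositional.Properties using (∈-++⁻; ∈-++⁺ˡ; ∈-++⁺ʳ; ∈-map⁻; ∈-map⁺; ∈-lookup)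
open import Data.List.Properties using (∷-injectiveʳ; ∷ʳ-injectiveˡ; ∷ʳ-injectiveʳ; ++-identityʳ; ++-assoc; ≡-dec; length-++; length-map)
open import Data.List.Relation.Unary.All as All using (All; []; _∷_)
import Data.List.Relation.Unary.All.Properties as All
open import Data.List.Relation.Unary.Any as Any using (here; there)
open import Data.List.Relation.Unary.Any.Properties using (lookup-index)
open import Data.List.Relation.Unary.Unique.Propositional using (Unique; []; _∷_)
import Data.List.Relation.Unary.Unique.Propositional.Properties as Unique
open import Data.Maybe using (Maybe; just; nothing; is-just)
open import Data.Maybe.Properties using (just-injective)
open import Data.Nat as ℕ using (ℕ; zero; suc)
import Data.Nat.Properties as ℕ
open import Data.Product using (Σ; ∃; _×_; _,_; proj₁; proj₂)
open import Data.Rational using (ℚ; 0ℚ; 1ℚ; ½; _+_; _-_; _*_; -_; _<_; _≤_; 1/_; _⊓_; Positive; NonNegative; NonZero; positive; ≢-nonZero)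
import Data.Rational.Properties as ℚ
open import Data.Rational.Solver using (module +-*-Solver)
open +-*-Solver using (solve; _:+_; _:*_; :-_; _:-_; _:=_; con)
open import Data.Sum using (_⊎_; inj₁; inj₂)
open import Data.Unit using (⊤; tt)
open import Data.Vec using (lookup; tabulate; []; _∷_)
open import Data.Vec.Properties using (tabulate∘lookup; lookup∘tabulate; tabulate-cong)
open import Induction.WellFounded using (WellFounded; Acc; acc)
open import Relation.Binary.Definitions using (tri<; tri≈; tri>)
open import Relation.Binary.PropositionalEquality
open import Relation.Nullary using (¬_; Dec; yes; no; ¬?; does)
open import Relation.Nullary.Decidable using (decidable-stable; dec-true; _×-dec_)
open import Relation.Unary using (Decidable)

-- Write h(w) for the number of right edges of a path w plus the binary fraction whose
-- digits are 1 at left and 0 at right edges.  Then v ≺ w iff h(v) < h(w), and h(w E₁) = h(w) + 1,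
-- so i ↦ h(v_T(i)) is a point of Φ(T) if all right internal edges of T are dashed; adding a
-- small multiple of a weight that is constant along dashed edges and grows along solid right edges
-- puts it in Φ(T).  Such weights have one degree of freedom per free node, which gives the
-- lower bound on the dimension, while any point of Φ(T) is determined up to constants by its
-- coordinates at free nodes, which gives the upper bound.
--
-- A point p of Φ(T) determines T: in increasing order of pᵢ, the position v_T(i) is the least
-- path that its comparisons with the earlier nodes and their right children allow, because
-- w E₀ is the immediate ≺-successor of w among all paths.  The same rule read as a
-- construction produces a tree from any point.

-- Heights fail to settle one case: a right child lies exactly 1 above its parent whether the edge
-- is dashed or solid. All other comparisons that define Φ(T) are strict inequalities of heights,
-- which survive a small perturbation, or come from equal positions, where the weights agree. So
-- only the ties along right edges have to be resolved, and the change of the weight along the edge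
-- does it. Since there are finitely many comparisons and weights, one size of perturbation serves
-- them all, and the points built for the lower bound on the dimension differ only in their weights.
-- Questions about faces reduce to single points: the faces and the sets Φ(T) are classes of one
-- equivalence relation on points, so a face and a Φ(T) that share a point coincide. Producing one
-- point of Φ(T) therefore shows that it is a face, a common point forces two trees to be equal, and
-- a face is reached by building the tree of any one of its points.

variable
  n : ℕ

-- Rational preliminaries

-- "For all sufficiently small positive e." It is closed under finite conjunctions, which yields one
-- perturbation size for all pairs of coordinates.
Eventually : (ℚ → Set) → Set
Eventually P = ∃ λ ε → 0ℚ < ε × (∀ e → 0ℚ < e → e ≤ ε → P e)

eventually-map : ∀ {P Q : ℚ → Set} → (∀ e → 0ℚ < e → P e → Q e) → Eventually P → Eventually Q
eventually-map f (ε , ε>0 , h) = ε , ε>0 , λ e e>0 e≤ε → f e e>0 (h e e>0 e≤ε)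

0<⊓ : ∀ p q → 0ℚ < p → 0ℚ < q → 0ℚ < p ⊓ q
0<⊓ p q p>0 q>0 with ℚ.⊓-sel p q
... | inj₁ eq = subst (0ℚ <_) (sym eq) p>0
... | inj₂ eq = subst (0ℚ <_) (sym eq) q>0

0<1 : 0ℚ < 1ℚ
0<1 = ℚ.positive⁻¹ 1ℚ

x<x+1 : ∀ x → x < x + 1ℚ
x<x+1 x = subst (_< x + 1ℚ) (ℚ.+-identityʳ x) (ℚ.+-monoʳ-< x 0<1)

eventually-× : ∀ {P Q : ℚ → Set} → Eventually P → Eventually Q → Eventually (λ e → P e × Q e)
eventually-× (ε , ε>0 , f) (η , η>0 , g) = ε ⊓ η , 0<⊓ ε η ε>0 η>0 , λ e e>0 e≤ →
  f e e>0 (ℚ.≤-trans e≤ (ℚ.p⊓q≤p ε η)) , g e e>0 (ℚ.≤-trans e≤ (ℚ.p⊓q≤q ε η))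

eventually-always : ∀ {P : ℚ → Set} → (∀ e → 0ℚ < e → P e) → Eventually P
eventually-always f = 1ℚ , 0<1 , λ e e>0 _ → f e e>0

eventually-∀ : ∀ {m} {P : Fin m → ℚ → Set} →
  (∀ i → Eventually (P i)) → Eventually (λ e → ∀ i → P i e)
eventually-∀ {zero} ev = eventually-always λ _ _ ()
eventually-∀ {suc m} ev =
  eventually-map (λ { e _ (a , b) → λ { zero → a ; (suc i) → b i } })
    (eventually-× (ev zero) (eventually-∀ (λ i → ev (suc i))))

eventually-*< : ∀ {x} d → 0ℚ < x → Eventually (λ e → e * d < x)
eventually-*< {x} d x>0 with ℚ.<-cmp 0ℚ d
... | tri≈ _ refl _ = eventually-always λ e _ → subst (_< x) (sym (ℚ.*-zeroʳ e)) x>0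
... | tri> _ _ d<0 = eventually-always λ e e>0 → ℚ.<-trans
  (subst (e * d <_) (ℚ.*-zeroʳ e) (ℚ.*-monoʳ-<-pos e {{positive e>0}} d<0)) x>0
-- The bound is `m / d` for some `m` strictly between 0 and `x`: with `x / d` the case `e = ε` would
-- give only `e * d ≤ x`.
... | tri< d>0 _ _ with ℚ.<-dense x>0
... | m , m>0 , m<x = m * d⁻¹ , ε>0 , λ e _ e≤ → ℚ.≤-<-trans (bound e e≤) m<x
  where
    instance
      d-pos : Positive d
      d-pos = positive d>0
      m-pos : Positive m
      m-pos = positive m>0
      d≢0 : NonZero d
      d≢0 = ℚ.pos⇒nonZero d
      d-nonNeg : NonNegative d
      d-nonNeg = ℚ.pos⇒nonNeg d
    d⁻¹ = 1/ d
    ε>0 : 0ℚ < m * d⁻¹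
    ε>0 = ℚ.positive⁻¹ _ {{ℚ.pos*pos⇒pos m d⁻¹ {{ℚ.1/pos⇒pos d}}}}
    bound : ∀ e → e ≤ m * d⁻¹ → e * d ≤ m
    bound e e≤ = subst (e * d ≤_)
      (trans (ℚ.*-assoc m d⁻¹ d) (trans (cong (m *_) (ℚ.*-inverseˡ d)) (ℚ.*-identityʳ m)))
      (ℚ.*-monoʳ-≤-nonNeg d e≤)

-- Finite sums and linear dependence

sum-cong : ∀ {m} {f g : Fin m → ℚ} → (∀ i → f i ≡ g i) → sumQ f ≡ sumQ g
sum-cong {zero} eq = refl
sum-cong {suc m} eq = cong₂ _+_ (eq zero) (sum-cong (λ i → eq (suc i)))

sum-+ : ∀ {m} (f g : Fin m → ℚ) → sumQ (λ i → f i + g i) ≡ sumQ f + sumQ g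
sum-+ {zero} f g = refl
sum-+ {suc m} f g = trans (cong ((f zero + g zero) +_) (sum-+ (λ i → f (suc i)) (λ i → g (suc i))))
  (solve 4 (λ a b c d → (a :+ b) :+ (c :+ d) := (a :+ c) :+ (b :+ d)) refl (f zero) (g zero) _ _)

sum-*ʳ : ∀ {m} (f : Fin m → ℚ) k → sumQ (λ i → f i * k) ≡ sumQ f * k
sum-*ʳ {zero} f k = sym (ℚ.*-zeroˡ k)
sum-*ʳ {suc m} f k = trans (cong (f zero * k +_) (sum-*ʳ (λ i → f (suc i)) k))
  (sym (ℚ.*-distribʳ-+ k (f zero) _))

sum-zero : ∀ {m} (f : Fin m → ℚ) → (∀ i → f i ≡ 0ℚ) → sumQ f ≡ 0ℚ
sum-zero {zero} f eq = refl
sum-zero {suc m} f eq = trans (cong₂ _+_ (eq zero) (sum-zero (λ i → f (suc i)) (λ i → eq (suc i)))) (ℚ.+-identityˡ 0ℚ)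

sum-single : ∀ {m} (f : Fin m → ℚ) i → (∀ j → j ≢ i → f j ≡ 0ℚ) → sumQ f ≡ f i
sum-single f zero off = trans (cong (f zero +_) (sum-zero _ (λ i → off (suc i) λ ()))) (ℚ.+-identityʳ (f zero))
sum-single f (suc i) off = trans
  (cong₂ _+_ (off zero λ ()) (sum-single (λ j → f (suc j)) i (λ j j≢i → off (suc j) (λ eq → j≢i (Fsuc-injective eq)))))
  (ℚ.+-identityˡ _)

*-≢0 : ∀ {p q} → p ≢ 0ℚ → q ≢ 0ℚ → p * q ≢ 0ℚ
*-≢0 {p} {q} p≢0 q≢0 pq≡0 = p≢0 (begin
  p                ≡⟨ sym (ℚ.*-identityʳ p) ⟩
  p * 1ℚ           ≡⟨ cong (p *_) (sym (ℚ.*-inverseʳ q)) ⟩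
  p * (q * 1/ q)   ≡⟨ sym (ℚ.*-assoc p q (1/ q)) ⟩
  p * q * 1/ q     ≡⟨ cong (_* 1/ q) pq≡0 ⟩
  0ℚ * 1/ q        ≡⟨ ℚ.*-zeroˡ (1/ q) ⟩
  0ℚ               ∎)
  where
    open ≡-Reasoning
    instance
      q-nonZero : NonZero q
      q-nonZero = ≢-nonZero q≢0

-- Gaussian elimination: the first vector, at a coordinate where it does not
-- vanish, clears that coordinate of the others.
dependent : ∀ {m} (M : Fin (suc m) → Fin m → ℚ) →
  ∃ λ (c : Fin (suc m) → ℚ) → (∀ x → sumQ (λ a → c a * M a x) ≡ 0ℚ) × ∃ λ a → c a ≢ 0ℚ
dependent {zero} M = (λ _ → 1ℚ) , (λ ()) , zero , λ ()
dependent {suc m} M with any? (λ x → ¬? (M zero x ℚ.≟ 0ℚ))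
... | no M₀≡0 = c , vanish , zero , λ ()
  where
    c : Fin (suc (suc m)) → ℚ
    c zero = 1ℚ
    c (suc _) = 0ℚ
    vanish : ∀ x → sumQ (λ a → c a * M a x) ≡ 0ℚ
    vanish x = sum-zero (λ a → c a * M a x) λ where
      zero → trans (ℚ.*-identityˡ _) (decidable-stable (M zero x ℚ.≟ 0ℚ) (λ ne → M₀≡0 (x , ne)))
      (suc a) → ℚ.*-zeroˡ (M (suc a) x)
-- Cross-multiplication clears the coordinate `x₀` without dividing. In a relation among the reduced
-- vectors, vector `suc b` enters with the factor `piv`, and the first vector collects the factors
-- `- M (suc b) x₀`; this is the `c` below.
... | yes (x₀ , piv≢0) with dependent
        (λ b y → M (suc b) (punchIn x₀ y) * M zero x₀ + (- M (suc b) x₀) * M zero (punchIn x₀ y))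
... | c′ , vanish′ , b₀ , c′≢0 = c , vanish , suc b₀ , *-≢0 c′≢0 piv≢0
  where
    piv : ℚ
    piv = M zero x₀
    s : ℚ
    s = sumQ (λ b → c′ b * (- M (suc b) x₀))
    c : Fin (suc (suc m)) → ℚ
    c zero = s
    c (suc b) = c′ b * piv
    split : ∀ y → sumQ (λ a → c a * M a y)
      ≡ sumQ (λ b → c′ b * (M (suc b) y * piv + (- M (suc b) x₀) * M zero y))
    split y = begin
      s * M zero y + sumQ (λ b → c′ b * piv * M (suc b) y)
        ≡⟨ cong (_+ sumQ (λ b → c′ b * piv * M (suc b) y)) (sym (sum-*ʳ (λ b → c′ b * (- M (suc b) x₀)) (M zero y))) ⟩
      sumQ (λ b → c′ b * (- M (suc b) x₀) * M zero y) + sumQ (λ b → c′ b * piv * M (suc b) y)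
        ≡⟨ sym (sum-+ (λ b → c′ b * (- M (suc b) x₀) * M zero y) (λ b → c′ b * piv * M (suc b) y)) ⟩
      sumQ (λ b → c′ b * (- M (suc b) x₀) * M zero y + c′ b * piv * M (suc b) y)
        ≡⟨ sum-cong (λ b → solve 5 (λ c n z p y → c :* (:- n) :* z :+ c :* p :* y := c :* (y :* p :+ (:- n) :* z))
             refl (c′ b) (M (suc b) x₀) (M zero y) piv (M (suc b) y)) ⟩
      sumQ (λ b → c′ b * (M (suc b) y * piv + (- M (suc b) x₀) * M zero y)) ∎
      where open ≡-Reasoning
    vanish : ∀ x → sumQ (λ a → c a * M a x) ≡ 0ℚ
    vanish x with x₀ ≟F x
    ... | yes refl = trans (split x) (sum-zero _ (λ b →
            solve 3 (λ c n p → c :* (n :* p :+ (:- n) :* p) := con 0ℚ) refl (c′ b) (M (suc b) x₀) piv))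
    ... | no x₀≢x = trans (split x) (subst
            (λ y → sumQ (λ b → c′ b * (M (suc b) y * piv + (- M (suc b) x₀) * M zero y)) ≡ 0ℚ)
            (punchIn-punchOut x₀≢x) (vanish′ (punchOut x₀≢x)))

-- The order on paths

-- The tie-break of `≺` by recursion along the common prefix: the lexicographic order with E₁ before
-- E₀ and a prefix before its extensions.
data _⊏_ : Path → Path → Set where
  []⊏  : ∀ {x w} → [] ⊏ (x ∷ w)
  R⊏L  : ∀ {v w} → (true ∷ v) ⊏ (false ∷ w)
  tail : ∀ x {v w} → v ⊏ w → (x ∷ v) ⊏ (x ∷ w)

⊏-sound : ∀ {v w} → v ⊏ w → ProperPrefix v w ⊎ FirstDiffRightLeft v w
⊏-sound []⊏ = inj₁ (_ , _ , refl)
⊏-sound R⊏L = inj₂ ([] , _ , _ , refl , refl)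
⊏-sound (tail x v⊏w) with ⊏-sound v⊏w
... | inj₁ (y , ys , eq) = inj₁ (y , ys , cong (x ∷_) eq)
... | inj₂ (u , v′ , w′ , eq , eq′) = inj₂ (x ∷ u , v′ , w′ , cong (x ∷_) eq , cong (x ∷_) eq′)

⊏-complete : ∀ {v w} → ProperPrefix v w ⊎ FirstDiffRightLeft v w → v ⊏ w
⊏-complete (inj₁ (x , xs , refl)) = prefix _
  where
    prefix : ∀ v → v ⊏ (v ++ (x ∷ xs))
    prefix [] = []⊏
    prefix (y ∷ v) = tail y (prefix v)
⊏-complete (inj₂ (u , v′ , w′ , refl , refl)) = diff u
  where
    diff : ∀ u → (u ++ (true ∷ v′)) ⊏ (u ++ (false ∷ w′))
    diff [] = R⊏L
    diff (y ∷ u) = tail y (diff u)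

⊏-total : ∀ v w → v ⊏ w ⊎ v ≡ w ⊎ w ⊏ v
⊏-total [] [] = inj₂ (inj₁ refl)
⊏-total [] (_ ∷ _) = inj₁ []⊏
⊏-total (_ ∷ _) [] = inj₂ (inj₂ []⊏)
⊏-total (true ∷ v) (false ∷ w) = inj₁ R⊏L
⊏-total (false ∷ v) (true ∷ w) = inj₂ (inj₂ R⊏L)
⊏-total (true ∷ v) (true ∷ w) with ⊏-total v w
... | inj₁ lt = inj₁ (tail true lt)
... | inj₂ (inj₁ refl) = inj₂ (inj₁ refl)
... | inj₂ (inj₂ gt) = inj₂ (inj₂ (tail true gt))
⊏-total (false ∷ v) (false ∷ w) with ⊏-total v w
... | inj₁ lt = inj₁ (tail false lt)
... | inj₂ (inj₁ refl) = inj₂ (inj₁ refl)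
... | inj₂ (inj₂ gt) = inj₂ (inj₂ (tail false gt))

≺-total : ∀ v w → v ≺ w ⊎ v ≡ w ⊎ w ≺ v
≺-total v w with ℕ.<-cmp (rdot v) (rdot w)
... | tri< lt _ _ = inj₁ (inj₁ lt)
... | tri> _ _ gt = inj₂ (inj₂ (inj₁ gt))
... | tri≈ _ eq _ with ⊏-total v w
... | inj₁ lt = inj₁ (inj₂ (eq , ⊏-sound lt))
... | inj₂ (inj₁ v≡w) = inj₂ (inj₁ v≡w)
... | inj₂ (inj₂ gt) = inj₂ (inj₂ (inj₂ (sym eq , ⊏-sound gt)))

-- The embedding of paths in ℚ

fromℕ : ℕ → ℚ
fromℕ zero = 0ℚ
fromℕ (suc m) = fromℕ m + 1ℚ

frac : Path → ℚ
frac [] = 0ℚ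
frac (true ∷ w) = ½ * frac w
frac (false ∷ w) = ½ * (1ℚ + frac w)

height : Path → ℚ
height w = fromℕ (rdot w) + frac w

private
  1+-mono : ∀ {x y} → x < y → 1ℚ + x < 1ℚ + y
  1+-mono = ℚ.+-monoʳ-< 1ℚ

  ½-mono : ∀ {x y} → x < y → ½ * x < ½ * y
  ½-mono = ℚ.*-monoʳ-<-pos ½

frac≥0 : ∀ w → 0ℚ ≤ frac w
frac≥0 [] = ℚ.≤-refl
frac≥0 (true ∷ w) = ℚ.*-monoˡ-≤-nonNeg ½ (frac≥0 w)
frac≥0 (false ∷ w) = ℚ.*-monoˡ-≤-nonNeg ½
  (ℚ.≤-trans (frac≥0 w) (subst (_≤ 1ℚ + frac w) (ℚ.+-identityˡ (frac w)) (ℚ.+-monoˡ-≤ (frac w) (ℚ.<⇒≤ 0<1))))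

½≤frac-left : ∀ w → ½ ≤ frac (false ∷ w)
½≤frac-left w = ℚ.*-monoˡ-≤-nonNeg ½ (ℚ.+-monoʳ-≤ 1ℚ (frac≥0 w))

frac<1 : ∀ w → frac w < 1ℚ
frac<1 [] = 0<1
frac<1 (true ∷ w) = ℚ.<-trans (½-mono (frac<1 w)) (½-mono (x<x+1 1ℚ))
frac<1 (false ∷ w) = ½-mono (1+-mono (frac<1 w))

-- Trailing right edges are digits 0 and leave `frac` unchanged, so a proper extension need not
-- increase it. With equal numbers of right edges the appended word consists of E₀ only, and its
-- first digit is 1.
frac-mono : ∀ {v w} → rdot v ≡ rdot w → v ⊏ w → frac v < frac w
frac-mono {w = false ∷ w} eq []⊏ = ℚ.<-≤-trans (ℚ.positive⁻¹ ½) (½≤frac-left w)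
frac-mono {true ∷ v} {false ∷ w} eq R⊏L = ℚ.<-≤-trans (½-mono (frac<1 v)) (½≤frac-left w)
frac-mono eq (tail true v⊏w) = ½-mono (frac-mono (ℕ.suc-injective eq) v⊏w)
frac-mono eq (tail false v⊏w) = ½-mono (1+-mono (frac-mono eq v⊏w))

fromℕ-mono : ∀ {a b} → a ℕ.≤ b → fromℕ a ≤ fromℕ b
fromℕ-mono {b = zero} ℕ.z≤n = ℚ.≤-refl
fromℕ-mono {b = suc b} ℕ.z≤n = ℚ.≤-trans (fromℕ-mono {b = b} ℕ.z≤n) (ℚ.<⇒≤ (x<x+1 (fromℕ b)))
fromℕ-mono (ℕ.s≤s a≤b) = ℚ.+-monoˡ-≤ 1ℚ (fromℕ-mono a≤b)

height-mono : ∀ {v w} → v ≺ w → height v < height w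
height-mono {v} {w} (inj₁ lt) = ℚ.<-≤-trans (ℚ.+-monoʳ-< (fromℕ (rdot v)) (frac<1 v))
  (ℚ.≤-trans (fromℕ-mono lt)
    (subst (_≤ height w) (ℚ.+-identityʳ _) (ℚ.+-monoʳ-≤ (fromℕ (rdot w)) (frac≥0 w))))
height-mono {v} {w} (inj₂ (eq , p)) = subst (λ m → height v < fromℕ m + frac w) eq
  (ℚ.+-monoʳ-< (fromℕ (rdot v)) (frac-mono eq (⊏-complete p)))

rdot-∷ʳtrue : ∀ w → rdot (w ∷ʳ true) ≡ suc (rdot w)
rdot-∷ʳtrue [] = refl
rdot-∷ʳtrue (true ∷ w) = cong suc (rdot-∷ʳtrue w)
rdot-∷ʳtrue (false ∷ w) = rdot-∷ʳtrue w

rdot-∷ʳfalse : ∀ w → rdot (w ∷ʳ false) ≡ rdot w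
rdot-∷ʳfalse [] = refl
rdot-∷ʳfalse (true ∷ w) = cong suc (rdot-∷ʳfalse w)
rdot-∷ʳfalse (false ∷ w) = rdot-∷ʳfalse w

frac-∷ʳtrue : ∀ w → frac (w ∷ʳ true) ≡ frac w
frac-∷ʳtrue [] = refl
frac-∷ʳtrue (true ∷ w) = cong (½ *_) (frac-∷ʳtrue w)
frac-∷ʳtrue (false ∷ w) = cong (λ x → ½ * (1ℚ + x)) (frac-∷ʳtrue w)

height-∷ʳtrue : ∀ w → height (w ∷ʳ true) ≡ height w + 1ℚ
height-∷ʳtrue w = trans (cong₂ (λ m x → fromℕ m + x) (rdot-∷ʳtrue w) (frac-∷ʳtrue w))
  (solve 3 (λ a b c → (a :+ b) :+ c := (a :+ c) :+ b) refl (fromℕ (rdot w)) 1ℚ (frac w))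

-- Totality makes `height` an order embedding, so transitivity and the monotonicity of appending E₁
-- are pulled back from ℚ without case distinctions on paths.
≺-reflects-height : ∀ {v w} → height v < height w → v ≺ w
≺-reflects-height {v} {w} lt with ≺-total v w
... | inj₁ v≺w = v≺w
... | inj₂ (inj₁ refl) = ⊥-elim (ℚ.<-irrefl refl lt)
... | inj₂ (inj₂ w≺v) = ⊥-elim (ℚ.<-asym lt (height-mono w≺v))

≺-irrefl : ∀ {w} → ¬ w ≺ w
≺-irrefl w≺w = ℚ.<-irrefl refl (height-mono w≺w)

≺-asym : ∀ {v w} → v ≺ w → ¬ w ≺ v
≺-asym v≺w w≺v = ℚ.<-asym (height-mono v≺w) (height-mono w≺v)

≺-trans : ∀ {u v w} → u ≺ v → v ≺ w → u ≺ w
≺-trans u≺v v≺w = ≺-reflects-height (ℚ.<-trans (height-mono u≺v) (height-mono v≺w))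

≺-⪯-trans : ∀ {u v w} → u ≺ v → v ⪯ w → u ≺ w
≺-⪯-trans u≺v (inj₁ v≺w) = ≺-trans u≺v v≺w
≺-⪯-trans u≺v (inj₂ refl) = u≺v

⪯-≺-trans : ∀ {u v w} → u ⪯ v → v ≺ w → u ≺ w
⪯-≺-trans (inj₁ u≺v) v≺w = ≺-trans u≺v v≺w
⪯-≺-trans (inj₂ refl) v≺w = v≺w

⪯-trans : ∀ {u v w} → u ⪯ v → v ⪯ w → u ⪯ w
⪯-trans (inj₁ u≺v) v⪯w = inj₁ (≺-⪯-trans u≺v v⪯w)
⪯-trans (inj₂ refl) v⪯w = v⪯w

⪯-antisym : ∀ {v w} → v ⪯ w → w ⪯ v → v ≡ w
⪯-antisym (inj₂ v≡w) _ = v≡w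
⪯-antisym (inj₁ v≺w) w⪯v = ⊥-elim (≺-irrefl (≺-⪯-trans v≺w w⪯v))

⊀⇒⪰ : ∀ {v w} → ¬ v ≺ w → w ⪯ v
⊀⇒⪰ {v} {w} v⊀w with ≺-total v w
... | inj₁ v≺w = ⊥-elim (v⊀w v≺w)
... | inj₂ (inj₁ v≡w) = inj₂ (sym v≡w)
... | inj₂ (inj₂ w≺v) = inj₁ w≺v

∷ʳtrue-mono : ∀ {v w} → v ≺ w → (v ∷ʳ true) ≺ (w ∷ʳ true)
∷ʳtrue-mono {v} {w} v≺w = ≺-reflects-height (subst₂ _<_ (sym (height-∷ʳtrue v)) (sym (height-∷ʳtrue w))
  (ℚ.+-monoˡ-< 1ℚ (height-mono v≺w)))

∷ʳtrue-mono-⪯ : ∀ {v w} → v ⪯ w → (v ∷ʳ true) ⪯ (w ∷ʳ true)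
∷ʳtrue-mono-⪯ (inj₁ v≺w) = inj₁ (∷ʳtrue-mono v≺w)
∷ʳtrue-mono-⪯ (inj₂ refl) = inj₂ refl

≺-∷ʳtrue : ∀ w → w ≺ (w ∷ʳ true)
≺-∷ʳtrue w = inj₁ (subst (rdot w ℕ.<_) (sym (rdot-∷ʳtrue w)) (ℕ.n<1+n (rdot w)))

≺-∷ʳfalse : ∀ w → w ≺ (w ∷ʳ false)
≺-∷ʳfalse w = inj₂ (sym (rdot-∷ʳfalse w) , inj₁ (false , [] , refl))

[]⪯ : ∀ w → [] ⪯ w
[]⪯ [] = inj₂ refl
[]⪯ (x ∷ w) with rdot (x ∷ w)
... | zero = inj₁ (inj₂ (refl , inj₁ (x , w , refl)))
... | suc m = inj₁ (inj₁ (ℕ.s≤s ℕ.z≤n))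

-- Appending E₀ keeps the number of right edges, which settles the case where `w` has more of them.
-- Otherwise `w` either branches off from `v` to the left, and so also from v E₀, or extends `v` by
-- a word without right edges, which starts with E₀.
∷ʳfalse-covers : ∀ {v w} → v ≺ w → (v ∷ʳ false) ⪯ w
∷ʳfalse-covers {v} {w} (inj₁ lt) = inj₁ (inj₁ (subst (ℕ._< rdot w) (sym (rdot-∷ʳfalse v)) lt))
∷ʳfalse-covers {v} {w} (inj₂ (eq , p)) with cover eq (⊏-complete p)
  where
    cover : ∀ {v w} → rdot v ≡ rdot w → v ⊏ w → (v ∷ʳ false) ⊏ w ⊎ (v ∷ʳ false) ≡ w
    cover {w = false ∷ []} eq []⊏ = inj₂ refl
    cover {w = false ∷ (y ∷ w)} eq []⊏ = inj₁ (tail false []⊏)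
    cover eq R⊏L = inj₁ R⊏L
    cover eq (tail true v⊏w) with cover (ℕ.suc-injective eq) v⊏w
    ... | inj₁ lt = inj₁ (tail true lt)
    ... | inj₂ refl = inj₂ refl
    cover eq (tail false v⊏w) with cover eq v⊏w
    ... | inj₁ lt = inj₁ (tail false lt)
    ... | inj₂ refl = inj₂ refl
... | inj₁ lt = inj₁ (inj₂ (trans (rdot-∷ʳfalse v) eq , ⊏-sound lt))
... | inj₂ v0≡w = inj₂ v0≡w

-- Nodes and dashed edges

LabelAt : BTree n → Path → Fin n → Set
LabelAt leaf _ _ = ⊥
LabelAt (node S l d r) [] i = lookup S i ≡ true
LabelAt (node S l d r) (false ∷ w) i = LabelAt l w i
LabelAt (node S l d r) (true ∷ w) i = LabelAt r w i

-- Like `LabelAt`, a recursive substitute for a notion of the statement: it marks the parent end of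
-- a dashed edge, and under `DashOK` amounts to captivity of the right child.
DashAt : BTree n → Path → Set
DashAt leaf _ = ⊥
DashAt (node S l d r) [] = d ≡ true
DashAt (node S l d r) (false ∷ w) = DashAt l w
DashAt (node S l d r) (true ∷ w) = DashAt r w

dashAt? : (t : BTree n) (w : Path) → Dec (DashAt t w)
dashAt? leaf w = no λ ()
dashAt? (node S l d r) [] = d Bool.≟ true
dashAt? (node S l d r) (false ∷ w) = dashAt? l w
dashAt? (node S l d r) (true ∷ w) = dashAt? r w

NonemptyLabels : BTree n → Set
NonemptyLabels leaf = ⊤
NonemptyLabels (node S l d r) = (∃ λ i → lookup S i ≡ true) × NonemptyLabels l × NonemptyLabels r

∣S∣≥1⇒∃ : (S : Subset n) → 1 ℕ.≤ ∣ S ∣ → ∃ λ i → lookup S i ≡ true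
∣S∣≥1⇒∃ (true ∷ S) _ = zero , refl
∣S∣≥1⇒∃ (false ∷ S) le with ∣S∣≥1⇒∃ S le
... | i , i∈S = suc i , i∈S

∃⇒∣S∣≥1 : (S : Subset n) (i : Fin n) → lookup S i ≡ true → 1 ℕ.≤ ∣ S ∣
∃⇒∣S∣≥1 (true ∷ S) i i∈S = ℕ.s≤s ℕ.z≤n
∃⇒∣S∣≥1 (false ∷ S) (suc i) i∈S = ∃⇒∣S∣≥1 S i i∈S

nonemptyLabels⁺ : (t : BTree n) → All (λ x → 1 ℕ.≤ ∣ proj₂ x ∣) (nodesOf t) → NonemptyLabels t
nonemptyLabels⁺ leaf _ = tt
nonemptyLabels⁺ (node S l d r) (S≥1 ∷ rest) with All.++⁻ (map _ (nodesOf l)) rest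
... | nl , nr = ∣S∣≥1⇒∃ S S≥1 , nonemptyLabels⁺ l (All.map⁻ nl) , nonemptyLabels⁺ r (All.map⁻ nr)

nonemptyLabels⁻ : (t : BTree n) → NonemptyLabels t → All (λ x → 1 ℕ.≤ ∣ proj₂ x ∣) (nodesOf t)
nonemptyLabels⁻ leaf _ = []
nonemptyLabels⁻ (node S l d r) ((i , i∈S) , nl , nr) =
  ∃⇒∣S∣≥1 S i i∈S ∷ All.++⁺ (All.map⁺ (nonemptyLabels⁻ l nl)) (All.map⁺ (nonemptyLabels⁻ r nr))

dashOK⁻ : ∀ {S} {l : BTree n} {d r} → DashOK (node S l d r) →
  DashOK l × DashOK r × (d ≡ true → ∃ λ S′ → ∃ λ l′ → ∃ λ d′ → ∃ λ r′ → r ≡ node S′ l′ d′ r′)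
dashOK⁻ {d = false} (okl , okr) = okl , okr , λ ()
dashOK⁻ {d = true} {node S′ l′ d′ r′} (okl , okr) = okl , okr , λ _ → S′ , l′ , d′ , r′ , refl

dashOK⁺ : ∀ {S} {l : BTree n} {d r} → DashOK l → DashOK r →
  (d ≡ true → ∃ λ w → ∃ λ i → LabelAt r w i) → DashOK (node S l d r)
dashOK⁺ {d = false} okl okr _ = okl , okr
dashOK⁺ {d = true} {node _ _ _ _} okl okr _ = okl , okr
dashOK⁺ {d = true} {leaf} _ _ right = proj₂ (proj₂ (right refl))

count : BTree n → Fin n → ℕ
count t i = countContaining i (nodesOf t)

count-++ : (i : Fin n) → ∀ xs ys →
  countContaining i (xs ++ ys) ≡ countContaining i xs ℕ.+ countContaining i ys
count-++ i [] ys = refl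
count-++ i ((w , S) ∷ xs) ys = trans (cong ((if lookup S i then 1 else 0) ℕ.+_) (count-++ i xs ys))
  (sym (ℕ.+-assoc (if lookup S i then 1 else 0) _ _))

count-map : (i : Fin n) (f : Path × Subset n → Path × Subset n) → (∀ x → proj₂ (f x) ≡ proj₂ x) →
  ∀ xs → countContaining i (map f xs) ≡ countContaining i xs
count-map i f eq [] = refl
count-map i f eq (x ∷ xs) = cong₂ ℕ._+_ (cong (λ S → if lookup S i then 1 else 0) (eq x)) (count-map i f eq xs)

count-node : ∀ S l d r (i : Fin n) →
  count (node S l d r) i ≡ (if lookup S i then 1 else 0) ℕ.+ (count l i ℕ.+ count r i)
count-node S l d r i = cong ((if lookup S i then 1 else 0) ℕ.+_)
  (trans (count-++ i (map _ (nodesOf l)) (map _ (nodesOf r)))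
    (cong₂ ℕ._+_ (count-map i _ (λ _ → refl) (nodesOf l)) (count-map i _ (λ _ → refl) (nodesOf r))))

firstContaining-∈ : (i : Fin n) → ∀ xs → 1 ℕ.≤ countContaining i xs →
  ∃ λ S → (firstContaining i xs , S) ∈ xs × lookup S i ≡ true
firstContaining-∈ i ((w , S) ∷ xs) le with lookup S i in eq
... | true = S , here refl , eq
... | false with firstContaining-∈ i xs le
... | S′ , mem , i∈S′ = S′ , there mem , i∈S′

∈nodesOf⇒LabelAt : ∀ (t : BTree n) {w S i} → (w , S) ∈ nodesOf t → lookup S i ≡ true → LabelAt t w i
∈nodesOf⇒LabelAt (node S l d r) (here refl) i∈S = i∈S
∈nodesOf⇒LabelAt (node S l d r) (there mem) i∈S with ∈-++⁻ (map _ (nodesOf l)) mem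
... | inj₁ meml with ∈-map⁻ _ meml
... | _ , mem′ , refl = ∈nodesOf⇒LabelAt l mem′ i∈S
∈nodesOf⇒LabelAt (node S l d r) (there mem) i∈S | inj₂ memr with ∈-map⁻ _ memr
... | _ , mem′ , refl = ∈nodesOf⇒LabelAt r mem′ i∈S

LabelAt⇒count≥1 : ∀ (t : BTree n) w {i} → LabelAt t w i → 1 ℕ.≤ count t i
LabelAt⇒count≥1 (node S l d r) [] {i} at rewrite count-node S l d r i | at = ℕ.s≤s ℕ.z≤n
LabelAt⇒count≥1 (node S l d r) (false ∷ w) {i} at rewrite count-node S l d r i =
  ℕ.≤-trans (LabelAt⇒count≥1 l w at) (ℕ.≤-trans (ℕ.m≤m+n _ (count r i)) (ℕ.m≤n+m _ (if lookup S i then 1 else 0)))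
LabelAt⇒count≥1 (node S l d r) (true ∷ w) {i} at rewrite count-node S l d r i =
  ℕ.≤-trans (LabelAt⇒count≥1 r w at) (ℕ.≤-trans (ℕ.m≤n+m _ (count l i)) (ℕ.m≤n+m _ (if lookup S i then 1 else 0)))

private
  two≰one : ∀ {a b} → 1 ℕ.≤ a → 1 ℕ.≤ b → ¬ a ℕ.+ b ℕ.≤ 1
  two≰one (ℕ.s≤s {n = a} _) (ℕ.s≤s {n = b} _) (ℕ.s≤s le) with ℕ.≤-trans (ℕ.m≤n+m (suc b) a) le
  ... | ()

-- Where the two paths part, they account for different summands of the count, and two positive
-- summands exceed 1.
LabelAt-unique : ∀ (t : BTree n) w w′ {i} → count t i ℕ.≤ 1 → LabelAt t w i → LabelAt t w′ i → w ≡ w′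
LabelAt-unique (node S l d r) w w′ {i} le at at′ rewrite count-node S l d r i = go w w′ at at′
  where
    s = if lookup S i then 1 else 0
    le-rest : count l i ℕ.+ count r i ℕ.≤ 1
    le-rest = ℕ.≤-trans (ℕ.m≤n+m _ s) le
    root-excludes : lookup S i ≡ true → ¬ 1 ℕ.≤ count l i ℕ.+ count r i
    root-excludes i∈S ge = two≰one {s} (subst (λ b → 1 ℕ.≤ (if b then 1 else 0)) (sym i∈S) (ℕ.s≤s ℕ.z≤n)) ge le
    inˡ : ∀ u → LabelAt l u i → 1 ℕ.≤ count l i ℕ.+ count r i
    inˡ u at = ℕ.≤-trans (LabelAt⇒count≥1 l u at) (ℕ.m≤m+n _ _)
    inʳ : ∀ u → LabelAt r u i → 1 ℕ.≤ count l i ℕ.+ count r i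
    inʳ u at = ℕ.≤-trans (LabelAt⇒count≥1 r u at) (ℕ.m≤n+m _ _)
    go : ∀ w w′ → LabelAt (node S l d r) w i → LabelAt (node S l d r) w′ i → w ≡ w′
    go [] [] _ _ = refl
    go [] (false ∷ u) at at′ = ⊥-elim (root-excludes at (inˡ u at′))
    go [] (true ∷ u) at at′ = ⊥-elim (root-excludes at (inʳ u at′))
    go (false ∷ u) [] at at′ = ⊥-elim (root-excludes at′ (inˡ u at))
    go (true ∷ u) [] at at′ = ⊥-elim (root-excludes at′ (inʳ u at))
    go (false ∷ u) (false ∷ u′) at at′ =
      cong (false ∷_) (LabelAt-unique l u u′ (ℕ.≤-trans (ℕ.m≤m+n _ _) le-rest) at at′)
    go (true ∷ u) (true ∷ u′) at at′ =
      cong (true ∷_) (LabelAt-unique r u u′ (ℕ.≤-trans (ℕ.m≤n+m _ _) le-rest) at at′)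
    go (false ∷ u) (true ∷ u′) at at′ = ⊥-elim (two≰one (LabelAt⇒count≥1 l u at) (LabelAt⇒count≥1 r u′ at′) le-rest)
    go (true ∷ u) (false ∷ u′) at at′ = ⊥-elim (two≰one (LabelAt⇒count≥1 l u′ at′) (LabelAt⇒count≥1 r u at) le-rest)

-- A parent has a nonempty label, hence an index: this is how parents become coordinates of a point.
LabelAt-init : ∀ (t : BTree n) w x {i} → NonemptyLabels t → LabelAt t (w ∷ʳ x) i → ∃ λ j → LabelAt t w j
LabelAt-init (node S l d r) [] x (root , _ , _) at = root
LabelAt-init (node S l d r) (false ∷ w) x (_ , nl , _) at = LabelAt-init l w x nl at
LabelAt-init (node S l d r) (true ∷ w) x (_ , _ , nr) at = LabelAt-init r w x nr at

DashAt⇒LabelAt : ∀ (t : BTree n) w → DashOK t → NonemptyLabels t → DashAt t w → ∃ λ i → LabelAt t (w ∷ʳ true) i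
DashAt⇒LabelAt (node S l d r) [] ok (_ , _ , nr) dash with proj₂ (proj₂ (dashOK⁻ ok)) dash
... | S′ , l′ , d′ , r′ , refl = proj₁ nr
DashAt⇒LabelAt (node S l d r) (false ∷ w) ok (_ , nl , _) dash =
  DashAt⇒LabelAt l w (proj₁ (dashOK⁻ {d = d} ok)) nl dash
DashAt⇒LabelAt (node S l d r) (true ∷ w) ok (_ , _ , nr) dash =
  DashAt⇒LabelAt r w (proj₁ (proj₂ (dashOK⁻ {d = d} ok))) nr dash

captive⇒DashAt : ∀ (t : BTree n) {w} → Captive t (w ∷ʳ true) → DashAt t w
captive⇒DashAt t {w} (u , eq , (S , l , r , at) , _) =
  subst (DashAt t) (sym (∷ʳ-injectiveˡ w u eq)) (go t u at)
  where
    go : ∀ t u {S l r} → subtreeAt t u ≡ just (node S l true r) → DashAt t u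
    go (node S l d r) [] refl = refl
    go (node S l d r) (false ∷ u) at = go l u at
    go (node S l d r) (true ∷ u) at = go r u at

DashAt⇒captive : ∀ (t : BTree n) w → DashOK t → DashAt t w → Captive t (w ∷ʳ true)
DashAt⇒captive {n} t w ok dash = w , refl , parent t w dash , child t w ok dash
  where
    parent : ∀ t w → DashAt t w → Σ (Subset n) λ S → Σ (BTree n) λ l → Σ (BTree n) λ r →
      subtreeAt t w ≡ just (node S l true r)
    parent (node S l d r) [] refl = S , l , r , refl
    parent (node S l d r) (false ∷ w) dash = parent l w dash
    parent (node S l d r) (true ∷ w) dash = parent r w dash
    child : ∀ t w → DashOK t → DashAt t w → Σ (Subset n) λ S → Σ (BTree n) λ l → Σ Bool λ d → Σ (BTree n) λ r →
      subtreeAt t (w ∷ʳ true) ≡ just (node S l d r)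
    child (node S l d r) [] ok dash with proj₂ (proj₂ (dashOK⁻ ok)) dash
    ... | S′ , l′ , d′ , r′ , refl = S′ , l′ , d′ , r′ , refl
    child (node S l d r) (false ∷ w) ok dash = child l w (proj₁ (dashOK⁻ {d = d} ok)) dash
    child (node S l d r) (true ∷ w) ok dash = child r w (proj₁ (proj₂ (dashOK⁻ {d = d} ok))) dash

private
  ≡true-ext : ∀ {a b} → (a ≡ true → b ≡ true) → (b ≡ true → a ≡ true) → a ≡ b
  ≡true-ext {true} f g = sym (f refl)
  ≡true-ext {false} {true} f g = g refl
  ≡true-ext {false} {false} f g = refl

-- Nonempty labels tell nodes from leaves: a leaf opposite a node would have to carry an index of
-- that node's label.
tree-ext : ∀ (t t′ : BTree n) → NonemptyLabels t → NonemptyLabels t′ →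
  (∀ w i → LabelAt t w i → LabelAt t′ w i) → (∀ w i → LabelAt t′ w i → LabelAt t w i) →
  (∀ w → DashAt t w → DashAt t′ w) → (∀ w → DashAt t′ w → DashAt t w) → t ≡ t′
tree-ext leaf leaf _ _ _ _ _ _ = refl
tree-ext leaf (node S l d r) _ ((i , i∈S) , _) _ g _ _ = ⊥-elim (g [] i i∈S)
tree-ext (node S l d r) leaf ((i , i∈S) , _) _ f _ _ _ = ⊥-elim (f [] i i∈S)
tree-ext (node S l d r) (node S′ l′ d′ r′) (_ , nl , nr) (_ , nl′ , nr′) f g df dg
  with trans (sym (tabulate∘lookup S)) (trans (tabulate-cong (λ i → ≡true-ext (f [] i) (g [] i))) (tabulate∘lookup S′))
     | tree-ext l l′ nl nl′ (λ w → f (false ∷ w)) (λ w → g (false ∷ w)) (λ w → df (false ∷ w)) (λ w → dg (false ∷ w))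
     | tree-ext r r′ nr nr′ (λ w → f (true ∷ w)) (λ w → g (true ∷ w)) (λ w → df (true ∷ w)) (λ w → dg (true ∷ w))
     | ≡true-ext (df []) (dg [])
... | refl | refl | refl | refl = refl

-- Trees from node paths

-- `nothing` marks the indices outside the subtree under construction, so that the recursion can
-- descend while the index set stays `Fin n`.
Placement : ℕ → Set
Placement n = Fin n → Maybe Path

stepInto : Bool → Maybe Path → Maybe Path
stepInto false (just (false ∷ w)) = just w
stepInto true (just (true ∷ w)) = just w
stepInto _ _ = nothing

stepInto⁻ : ∀ x {m w} → stepInto x m ≡ just w → m ≡ just (x ∷ w)
stepInto⁻ false {just (false ∷ w)} refl = refl
stepInto⁻ true {just (true ∷ w)} refl = refl
stepInto⁻ false {just (true ∷ w)} ()
stepInto⁻ true {just (false ∷ w)} ()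
stepInto⁻ false {just []} ()
stepInto⁻ true {just []} ()

stepInto⁺ : ∀ x {m w} → m ≡ just (x ∷ w) → stepInto x m ≡ just w
stepInto⁺ false refl = refl
stepInto⁺ true refl = refl

atRoot : Maybe Path → Bool
atRoot (just []) = true
atRoot _ = false

placed? : (a : Placement n) → Dec (∃ λ i → ∃ λ w → a i ≡ just w)
placed? a = any? λ i → placed1 (a i)
  where
    placed1 : ∀ m → Dec (∃ λ w → m ≡ just {A = Path} w)
    placed1 (just w) = yes (w , refl)
    placed1 nothing = no λ ()

-- The first argument bounds the depth.
treeOf : ℕ → Placement n → (Path → Bool) → BTree n
treeOf zero a δ = leaf
treeOf (suc N) a δ with placed? a
... | no _ = leaf
... | yes _ = node (tabulate (λ i → atRoot (a i)))
    (treeOf N (λ i → stepInto false (a i)) (λ w → δ (false ∷ w))) (δ [])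
    (treeOf N (λ i → stepInto true (a i)) (λ w → δ (true ∷ w)))

-- These conditions pass to both subtrees. In order they ensure that the recursion does not stop
-- above a placed index, that every node it creates has a nonempty label, and that every dashed edge
-- ends at a node.
record Valid (N : ℕ) (a : Placement n) (δ : Path → Bool) : Set where
  field
    bounded : ∀ i w → a i ≡ just w → length w ℕ.< N
    prefix-closed : ∀ i u v → a i ≡ just (u ++ v) → ∃ λ j → a j ≡ just u
    dash-child : ∀ w → δ w ≡ true → ∃ λ i → a i ≡ just (w ∷ʳ true)
open Valid

valid-step : ∀ {N} {a : Placement n} {δ} x → Valid (suc N) a δ → Valid N (λ i → stepInto x (a i)) (λ w → δ (x ∷ w))
valid-step x v .bounded i w eq = ℕ.s≤s⁻¹ (v .bounded i (x ∷ w) (stepInto⁻ x eq))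
valid-step x v .prefix-closed i u u′ eq with v .prefix-closed i (x ∷ u) u′ (stepInto⁻ x eq)
... | j , eq′ = j , stepInto⁺ x eq′
valid-step x v .dash-child w eq with v .dash-child (x ∷ w) eq
... | i , eq′ = i , stepInto⁺ x eq′

treeOf-label⁺ : ∀ N {a : Placement n} {δ} → Valid N a δ → ∀ w i → a i ≡ just w → LabelAt (treeOf N a δ) w i
treeOf-label⁺ zero v w i eq with v .bounded i w eq
... | ()
treeOf-label⁺ (suc N) {a} v w i eq with placed? a
... | no ∄ = ⊥-elim (∄ (i , w , eq))
treeOf-label⁺ (suc N) {a} v [] i eq | yes _ = trans (lookup∘tabulate _ i) (cong atRoot eq)
treeOf-label⁺ (suc N) {a} v (false ∷ w) i eq | yes _ = treeOf-label⁺ N (valid-step false v) w i (stepInto⁺ false eq)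
treeOf-label⁺ (suc N) {a} v (true ∷ w) i eq | yes _ = treeOf-label⁺ N (valid-step true v) w i (stepInto⁺ true eq)

treeOf-dash⁻ : ∀ N {a : Placement n} {δ} w → DashAt (treeOf N a δ) w → δ w ≡ true
treeOf-dash⁻ (suc N) {a} w dash with placed? a
treeOf-dash⁻ (suc N) {a} [] dash | yes _ = dash
treeOf-dash⁻ (suc N) {a} (false ∷ w) dash | yes _ = treeOf-dash⁻ N w dash
treeOf-dash⁻ (suc N) {a} (true ∷ w) dash | yes _ = treeOf-dash⁻ N w dash

treeOf-dash⁺ : ∀ N {a : Placement n} {δ} → Valid N a δ → ∀ w i → a i ≡ just w → δ w ≡ true → DashAt (treeOf N a δ) w
treeOf-dash⁺ zero v w i eq _ with v .bounded i w eq
... | ()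
treeOf-dash⁺ (suc N) {a} v w i eq δw with placed? a
... | no ∄ = ⊥-elim (∄ (i , w , eq))
treeOf-dash⁺ (suc N) {a} v [] i eq δw | yes _ = δw
treeOf-dash⁺ (suc N) {a} v (false ∷ w) i eq δw | yes _ = treeOf-dash⁺ N (valid-step false v) w i (stepInto⁺ false eq) δw
treeOf-dash⁺ (suc N) {a} v (true ∷ w) i eq δw | yes _ = treeOf-dash⁺ N (valid-step true v) w i (stepInto⁺ true eq) δw

treeOf-nonempty : ∀ N {a : Placement n} {δ} → Valid N a δ → NonemptyLabels (treeOf N a δ)
treeOf-nonempty zero v = tt
treeOf-nonempty (suc N) {a} v with placed? a
... | no _ = tt
... | yes (i , w , eq) with v .prefix-closed i [] w eq
... | j , eq′ = (j , trans (lookup∘tabulate _ j) (cong atRoot eq′)) ,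
  treeOf-nonempty N (valid-step false v) , treeOf-nonempty N (valid-step true v)

treeOf-dashOK : ∀ N {a : Placement n} {δ} → Valid N a δ → DashOK (treeOf N a δ)
treeOf-dashOK zero v = tt
treeOf-dashOK (suc N) {a} v with placed? a
... | no _ = tt
... | yes _ = dashOK⁺ (treeOf-dashOK N (valid-step false v)) (treeOf-dashOK N (valid-step true v)) right
  where
    right : _ → _
    right δ≡true with v .dash-child [] δ≡true
    ... | i , eq = [] , i , treeOf-label⁺ N (valid-step true v) [] i (stepInto⁺ true eq)

-- Stated for partial placements to make the induction work: of the root and the two subtrees
-- exactly one receives a placed index.
treeOf-count : ∀ N {a : Placement n} {δ} → Valid N a δ → ∀ i →
  count (treeOf N a δ) i ≡ (if is-just (a i) then 1 else 0)
treeOf-count zero {a} v i with a i in eq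
... | nothing = refl
... | just w with v .bounded i w eq
... | ()
treeOf-count (suc N) {a} v i with placed? a
... | no ∄ with a i in eq
... | nothing = refl
... | just w = ⊥-elim (∄ (i , w , eq))
treeOf-count (suc N) {a} {δ} v i | yes _
  rewrite count-node (tabulate (λ i → atRoot (a i)))
            (treeOf N (λ i → stepInto false (a i)) (λ w → δ (false ∷ w))) (δ [])
            (treeOf N (λ i → stepInto true (a i)) (λ w → δ (true ∷ w))) i
        | lookup∘tabulate (λ i → atRoot (a i)) i
        | treeOf-count N (valid-step false v) i
        | treeOf-count N (valid-step true v) i
  with a i
... | nothing = refl
... | just [] = refl
... | just (false ∷ w) = refl
... | just (true ∷ w) = refl

-- Points of Φ(T)

module _ (T : DecTree n) where
  private t = proj₁ T

  dashOK : DashOK t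
  dashOK = proj₁ (proj₂ T)

  nonempty : NonemptyLabels t
  nonempty = nonemptyLabels⁺ t (proj₁ (proj₂ (proj₂ T)))

  vT-label : ∀ i → LabelAt t (vT t i) i
  vT-label i with firstContaining-∈ i (nodesOf t) (ℕ.≤-reflexive (sym (proj₂ (proj₂ (proj₂ T)) i)))
  ... | S , mem , i∈S = ∈nodesOf⇒LabelAt t mem i∈S

  vT-unique : ∀ w {i} → LabelAt t w i → vT t i ≡ w
  vT-unique w {i} at = LabelAt-unique t _ w (ℕ.≤-reflexive (proj₂ (proj₂ (proj₂ T)) i)) (vT-label i) at

  -- Only implications from the tree to the point. The hypotheses exhaust the relative positions of
  -- v_T(i) with v_T(j) and with the right child of v_T(j), so the converses in `PhiSet` follow by
  -- trichotomy.
  record Compatible (p : Point n) (i j : Fin n) : Set where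
    field
      lt   : vT t i ≺ vT t j → p i < p j
      eq   : vT t i ≡ vT t j → p i ≡ p j
      lt₁  : vT t i ≺ v1T t j → p i < p j + 1ℚ
      gt₁  : v1T t j ≺ vT t i → p j + 1ℚ < p i
      dash : vT t i ≡ v1T t j → DashAt t (vT t j) → p i ≡ p j + 1ℚ
      free : vT t i ≡ v1T t j → ¬ DashAt t (vT t j) → p j + 1ℚ < p i
  open Compatible

  compatible⇒PhiSet : ∀ p → (∀ i j → Compatible p i j) → PhiSet t p
  compatible⇒PhiSet p c i j = (le⇒ , ⇒le) , (lt⇒ , c i j .lt₁) , (eq⇒ , ⇒eq)
    where
      le⇒ : p i ≤ p j → vT t i ⪯ vT t j
      le⇒ pi≤pj = ⊀⇒⪰ λ vj≺vi → ℚ.<-irrefl refl (ℚ.<-≤-trans (c j i .lt vj≺vi) pi≤pj)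
      ⇒le : vT t i ⪯ vT t j → p i ≤ p j
      ⇒le (inj₁ vi≺vj) = ℚ.<⇒≤ (c i j .lt vi≺vj)
      ⇒le (inj₂ vi≡vj) = ℚ.≤-reflexive (c i j .eq vi≡vj)
      at-right-child : vT t i ≡ v1T t j → ¬ p i < p j + 1ℚ
      at-right-child vi≡ pi< with dashAt? t (vT t j)
      ... | yes d = ℚ.<-irrefl (c i j .dash vi≡ d) pi<
      ... | no ¬d = ℚ.<-asym (c i j .free vi≡ ¬d) pi<
      lt⇒ : p i < p j + 1ℚ → vT t i ≺ v1T t j
      lt⇒ pi< with ≺-total (vT t i) (v1T t j)
      ... | inj₁ vi≺ = vi≺
      ... | inj₂ (inj₁ vi≡) = ⊥-elim (at-right-child vi≡ pi<)
      ... | inj₂ (inj₂ ≺vi) = ⊥-elim (ℚ.<-asym (c i j .gt₁ ≺vi) pi<)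
      eq⇒ : p i ≡ p j + 1ℚ → (vT t i ≡ v1T t j) × Captive t (v1T t j)
      eq⇒ pi≡ with ≺-total (vT t i) (v1T t j)
      ... | inj₁ vi≺ = ⊥-elim (ℚ.<-irrefl pi≡ (c i j .lt₁ vi≺))
      ... | inj₂ (inj₂ ≺vi) = ⊥-elim (ℚ.<-irrefl (sym pi≡) (c i j .gt₁ ≺vi))
      ... | inj₂ (inj₁ vi≡) with dashAt? t (vT t j)
      ... | yes d = vi≡ , DashAt⇒captive t (vT t j) dashOK d
      ... | no ¬d = ⊥-elim (ℚ.<-irrefl (sym pi≡) (c i j .free vi≡ ¬d))
      ⇒eq : (vT t i ≡ v1T t j) × Captive t (v1T t j) → p i ≡ p j + 1ℚ
      ⇒eq (vi≡ , captive) = c i j .dash vi≡ (captive⇒DashAt t captive)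

  record Weight (δ : Fin n → ℚ) : Set where
    field
      same-node : ∀ i j → vT t i ≡ vT t j → δ i ≡ δ j
      dashed    : ∀ i j → vT t i ≡ v1T t j → DashAt t (vT t j) → δ i ≡ δ j
      solid     : ∀ i j → vT t i ≡ v1T t j → ¬ DashAt t (vT t j) → δ j < δ i
  open Weight

  perturbed : (Fin n → ℚ) → ℚ → Point n
  perturbed δ e i = height (vT t i) + e * δ i

  private
    gap-kept : ∀ x y a b → x < y → Eventually (λ e → x + e * a < y + e * b)
    gap-kept x y a b x<y = eventually-map
      (λ e _ small → subst₂ _<_
        (solve 4 (λ e a b x → e :* (a :- b) :+ (x :+ e :* b) := x :+ e :* a) refl e a b x)
        (solve 4 (λ e y b x → (y :- x) :+ (x :+ e :* b) := y :+ e :* b) refl e y b x)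
        (ℚ.+-monoˡ-< (x + e * b) small))
      (eventually-*< (a - b) (subst (_< y - x) (ℚ.+-inverseʳ x) (ℚ.+-monoˡ-< (- x) x<y)))

    +1-out : ∀ y e b → (y + 1ℚ) + e * b ≡ (y + e * b) + 1ℚ
    +1-out y e b = solve 3 (λ y o z → (y :+ o) :+ z := (y :+ z) :+ o) refl y 1ℚ (e * b)

  -- A strict inequality of heights persists for small `e`. When v_T(i) equals v_T(j) or its right
  -- child, the height terms cancel and the weights decide for every positive `e`.
  perturbed-compatible : ∀ {δ} → Weight δ → ∀ i j → Eventually (λ e → Compatible (perturbed δ e) i j)
  perturbed-compatible {δ} W i j = eventually-map
      (λ { e _ ((a , b) , (c , d , f , g)) → record { lt = a ; eq = b ; lt₁ = c ; gt₁ = d ; dash = f ; free = g } })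
      (eventually-× part₀ part₁)
    where
      vi = vT t i
      vj = vT t j
      hi = height vi
      hj = height vj
      P : ℚ → Point n
      P = perturbed δ
      part₀ : Eventually (λ e → (vi ≺ vj → P e i < P e j) × (vi ≡ vj → P e i ≡ P e j))
      part₀ with ≺-total vi vj
      ... | inj₁ vi≺vj = eventually-map
              (λ e _ lt → (λ _ → lt) , λ vi≡vj → ⊥-elim (≺-irrefl (subst (_≺ vj) vi≡vj vi≺vj)))
              (gap-kept hi hj (δ i) (δ j) (height-mono vi≺vj))
      ... | inj₂ (inj₂ vj≺vi) = eventually-always (λ e _ →
              (λ vi≺vj → ⊥-elim (≺-asym vi≺vj vj≺vi)) , λ vi≡vj → ⊥-elim (≺-irrefl (subst (vj ≺_) vi≡vj vj≺vi)))
      ... | inj₂ (inj₁ vi≡vj) = eventually-always λ e _ →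
              (λ vi≺vj → ⊥-elim (≺-irrefl (subst (_≺ vj) vi≡vj vi≺vj))) ,
              λ _ → cong₂ (λ v x → height v + e * x) vi≡vj (same-node W i j vi≡vj)
      hj1 = hj + 1ℚ
      h1 : height (v1T t j) ≡ hj1
      h1 = height-∷ʳtrue vj
      part₁ : Eventually (λ e → (vi ≺ v1T t j → P e i < P e j + 1ℚ) × (v1T t j ≺ vi → P e j + 1ℚ < P e i) ×
                (vi ≡ v1T t j → DashAt t vj → P e i ≡ P e j + 1ℚ) × (vi ≡ v1T t j → ¬ DashAt t vj → P e j + 1ℚ < P e i))
      part₁ with ≺-total vi (v1T t j)
      ... | inj₁ vi≺ = eventually-map
              (λ e _ lt → (λ _ → subst (P e i <_) (+1-out hj e (δ j)) lt) , (λ ≺vi → ⊥-elim (≺-asym vi≺ ≺vi)) ,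
                (λ vi≡ → ⊥-elim (≺-irrefl (subst (_≺ v1T t j) vi≡ vi≺))) ,
                (λ vi≡ → ⊥-elim (≺-irrefl (subst (_≺ v1T t j) vi≡ vi≺))))
              (gap-kept hi hj1 (δ i) (δ j) (subst (hi <_) h1 (height-mono vi≺)))
      ... | inj₂ (inj₂ ≺vi) = eventually-map
              (λ e _ lt → (λ vi≺ → ⊥-elim (≺-asym vi≺ ≺vi)) , (λ _ → subst (_< P e i) (+1-out hj e (δ j)) lt) ,
                (λ vi≡ → ⊥-elim (≺-irrefl (subst (v1T t j ≺_) vi≡ ≺vi))) ,
                (λ vi≡ → ⊥-elim (≺-irrefl (subst (v1T t j ≺_) vi≡ ≺vi))))
              (gap-kept hj1 hi (δ j) (δ i) (subst (_< hi) h1 (height-mono ≺vi)))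
      ... | inj₂ (inj₁ vi≡) = eventually-always λ e e>0 →
              (λ vi≺ → ⊥-elim (≺-irrefl (subst (_≺ v1T t j) vi≡ vi≺))) ,
              (λ ≺vi → ⊥-elim (≺-irrefl (subst (v1T t j ≺_) vi≡ ≺vi))) ,
              (λ _ d → trans (cong₂ (λ h x → h + e * x) hi≡ (dashed W i j vi≡ d)) (+1-out hj e (δ j))) ,
              (λ _ ¬d → subst₂ _<_ (+1-out hj e (δ j)) (cong (_+ e * δ i) (sym hi≡))
                (ℚ.+-monoʳ-< hj1 (ℚ.*-monoʳ-<-pos e {{positive e>0}} (solid W i j vi≡ ¬d))))
        where
          hi≡ : hi ≡ hj1
          hi≡ = trans (cong height vi≡) h1

  -- A common `e` for the whole family lets it be factored out of the linear relation in the proof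
  -- of affine independence.
  perturbed∈PhiSet : ∀ {m} (δ : Fin m → Fin n → ℚ) → (∀ a → Weight (δ a)) →
    ∃ λ e → 0ℚ < e × (∀ a → PhiSet t (perturbed (δ a) e))
  perturbed∈PhiSet δ W with eventually-∀ (λ a → eventually-∀ (λ i → eventually-∀ (λ j → perturbed-compatible (W a) i j)))
  ... | ε , ε>0 , f = ε , ε>0 , λ a → compatible⇒PhiSet _ (f ε ε>0 ℚ.≤-refl a)

-- Points on the same side of every hyperplane

-- `p ⊑ q` together with `q ⊑ p` means lying in the same face. Any two points of one `PhiSet t`, or
-- of one solution set `Sol σ`, are related in both directions, and both kinds of set are closed
-- under this equivalence.
_⊑_ : Point n → Point n → Set
p ⊑ q = ∀ i j → (p i ≤ p j → q i ≤ q j) × (p i < p j + 1ℚ → q i < q j + 1ℚ) × (p i ≡ p j + 1ℚ → q i ≡ q j + 1ℚ)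

PhiSet-⊑ : ∀ (t : BTree n) {p q} → PhiSet t p → PhiSet t q → p ⊑ q
PhiSet-⊑ t φ ψ i j with φ i j | ψ i j
... | (a , _) , (b , _) , (c , _) | (_ , a′) , (_ , b′) , (_ , c′) = (λ x → a′ (a x)) , (λ x → b′ (b x)) , (λ x → c′ (c x))

PhiSet-resp : ∀ (t : BTree n) {p q} → p ⊑ q → q ⊑ p → PhiSet t p → PhiSet t q
PhiSet-resp t p⊑q q⊑p φ i j with φ i j | p⊑q i j | q⊑p i j
... | (a , a′) , (b , b′) , (c , c′) | f , g , h | f′ , g′ , h′ =
  ((λ x → a (f′ x)) , λ x → f (a′ x)) , ((λ x → b (g′ x)) , λ x → g (b′ x)) , ((λ x → c (h′ x)) , λ x → h (c′ x))

private
  cancel : ∀ x y → (x - y) + y ≡ x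
  cancel x y = solve 2 (λ x y → (x :- y) :+ y := x) refl x y
  cancel′ : ∀ c y → (y + c) - y ≡ c
  cancel′ c y = solve 2 (λ c y → (y :+ c) :- y := c) refl c y

SignRel-add : ∀ s {x y c} → SignRel s (x - y) c → SignRel s x (y + c)
SignRel-add neg {x} {y} {c} lt = subst₂ _<_ (cancel x y) (ℚ.+-comm c y) (ℚ.+-monoˡ-< y lt)
SignRel-add zer {x} {y} {c} eq = trans (sym (cancel x y)) (trans (cong (_+ y) eq) (ℚ.+-comm c y))
SignRel-add pos {x} {y} {c} gt = subst₂ _<_ (ℚ.+-comm c y) (cancel x y) (ℚ.+-monoˡ-< y gt)

SignRel-sub : ∀ s {x y c} → SignRel s x (y + c) → SignRel s (x - y) c
SignRel-sub neg {x} {y} {c} lt = subst (x - y <_) (cancel′ c y) (ℚ.+-monoˡ-< (- y) lt)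
SignRel-sub zer {x} {y} {c} eq = trans (cong (_- y) eq) (cancel′ c y)
SignRel-sub pos {x} {y} {c} gt = subst (_< x - y) (cancel′ c y) (ℚ.+-monoˡ-< (- y) gt)

private
  ≤-transfer : ∀ s {x y x′ y′} → SignRel s x y → SignRel s x′ y′ → x ≤ y → x′ ≤ y′
  ≤-transfer neg _ lt′ _ = ℚ.<⇒≤ lt′
  ≤-transfer zer _ eq′ _ = ℚ.≤-reflexive eq′
  ≤-transfer pos gt _ le = ⊥-elim (ℚ.<-irrefl refl (ℚ.<-≤-trans gt le))

  <-transfer : ∀ s {x y x′ y′} → SignRel s x y → SignRel s x′ y′ → x < y → x′ < y′
  <-transfer neg _ lt′ _ = lt′
  <-transfer zer eq _ lt = ⊥-elim (ℚ.<-irrefl eq lt)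
  <-transfer pos gt _ lt = ⊥-elim (ℚ.<-asym gt lt)

  ≡-transfer : ∀ s {x y x′ y′} → SignRel s x y → SignRel s x′ y′ → x ≡ y → x′ ≡ y′
  ≡-transfer neg lt _ eq = ⊥-elim (ℚ.<-irrefl eq lt)
  ≡-transfer zer _ eq′ _ = eq′
  ≡-transfer pos gt _ eq = ⊥-elim (ℚ.<-irrefl (sym eq) gt)

Sol-⊑ : ∀ {σ : SignAssignment n} {p q} → Sol σ p → Sol σ q → p ⊑ q
Sol-⊑ {σ = σ} {p} {q} sp sq i j with i ≟F j
-- No hyperplane compares a coordinate with itself, but the truth values of these comparisons are
-- fixed.
... | yes refl = (λ _ → ℚ.≤-refl) , (λ _ → x<x+1 (q i)) , λ eq → ⊥-elim (ℚ.<-irrefl eq (x<x+1 (p i)))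
... | no i≢j = ≤-transfer (σ i j i≢j false) (at₀ sp) (at₀ sq) ,
    <-transfer (σ i j i≢j true) (SignRel-add (σ i j i≢j true) (sp i j i≢j true)) (SignRel-add (σ i j i≢j true) (sq i j i≢j true)) ,
    ≡-transfer (σ i j i≢j true) (SignRel-add (σ i j i≢j true) (sp i j i≢j true)) (SignRel-add (σ i j i≢j true) (sq i j i≢j true))
  where
    at₀ : ∀ {r} → Sol σ r → SignRel (σ i j i≢j false) (r i) (r j)
    at₀ {r} sr = subst (SignRel (σ i j i≢j false) (r i)) (ℚ.+-identityʳ (r j))
      (SignRel-add (σ i j i≢j false) (sr i j i≢j false))

-- For the difference 0 the relation `⊑` transports only `≤`, and for the difference 1 only `<` and
-- `=`; the remaining signs come from `q ⊑ p` by contraposition.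
Sol-resp : ∀ {σ : SignAssignment n} {p q} → p ⊑ q → q ⊑ p → Sol σ p → Sol σ q
Sol-resp {σ = σ} {p} {q} p⊑q q⊑p sp i j ne k = SignRel-sub (σ i j ne k) (go k (σ i j ne k) (SignRel-add (σ i j ne k) (sp i j ne k)))
  where
    go₀ : ∀ s → SignRel s (p i) (p j) → SignRel s (q i) (q j)
    go₀ neg lt = ℚ.≰⇒> λ le → ℚ.<-irrefl refl (ℚ.<-≤-trans lt (proj₁ (q⊑p j i) le))
    go₀ zer eq = ℚ.≤-antisym (proj₁ (p⊑q i j) (ℚ.≤-reflexive eq)) (proj₁ (p⊑q j i) (ℚ.≤-reflexive (sym eq)))
    go₀ pos gt = ℚ.≰⇒> λ le → ℚ.<-irrefl refl (ℚ.<-≤-trans gt (proj₁ (q⊑p i j) le))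
    go₁ : ∀ s → SignRel s (p i) (p j + 1ℚ) → SignRel s (q i) (q j + 1ℚ)
    go₁ neg lt = proj₁ (proj₂ (p⊑q i j)) lt
    go₁ zer eq = proj₂ (proj₂ (p⊑q i j)) eq
    go₁ pos gt with ℚ.<-cmp (q i) (q j + 1ℚ)
    ... | tri> _ _ gt′ = gt′
    ... | tri< lt′ _ _ = ⊥-elim (ℚ.<-asym gt (proj₁ (proj₂ (q⊑p i j)) lt′))
    ... | tri≈ _ eq′ _ = ⊥-elim (ℚ.<-irrefl (sym (proj₂ (proj₂ (q⊑p i j)) eq′)) gt)
    go : ∀ k s → SignRel s (p i) (p j + const k) → SignRel s (q i) (q j + const k)
    go false s rel = subst (SignRel s (q i)) (sym (ℚ.+-identityʳ (q j)))
      (go₀ s (subst (SignRel s (p i)) (ℚ.+-identityʳ (p j)) rel))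
    go true s rel = go₁ s rel

sign : ℚ → ℚ → Sign
sign x c with ℚ.<-cmp x c
... | tri< _ _ _ = neg
... | tri≈ _ _ _ = zer
... | tri> _ _ _ = pos

sign-spec : ∀ x c → SignRel (sign x c) x c
sign-spec x c with ℚ.<-cmp x c
... | tri< lt _ _ = lt
... | tri≈ _ eq _ = eq
... | tri> _ _ gt = gt

PhiSet-isFace : ∀ (t : BTree n) p → PhiSet t p → IsFace (PhiSet t)
PhiSet-isFace t p φ = σ , (p , sol) , λ q →
    (λ ψ → Sol-resp {σ = σ} (PhiSet-⊑ t φ ψ) (PhiSet-⊑ t ψ φ) sol) ,
    (λ sq → PhiSet-resp t (Sol-⊑ {σ = σ} sol sq) (Sol-⊑ {σ = σ} sq sol) φ)
  where
    σ = λ i j _ k → sign (p i - p j) (const k)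
    sol : Sol σ p
    sol i j _ k = sign-spec (p i - p j) (const k)

face≐PhiSet : ∀ (t : BTree n) {F} (face : IsFace F) → PhiSet t (proj₁ (proj₁ (proj₂ face))) → F ≐ PhiSet t
face≐PhiSet t (σ , (p , sol) , F⇔Sol) φ q =
  (λ Fq → let sq = proj₁ (F⇔Sol q) Fq in PhiSet-resp t (Sol-⊑ {σ = σ} sol sq) (Sol-⊑ {σ = σ} sq sol) φ) ,
  (λ ψ → proj₂ (F⇔Sol q) (Sol-resp {σ = σ} (PhiSet-⊑ t φ ψ) (PhiSet-⊑ t ψ φ) sol))

wellFounded-by : (p : Point n) → WellFounded (λ i j → p i < p j)
wellFounded-by p = spo-wellFounded (record
  { isEquivalence = isEquivalence
  ; irrefl = λ { refl → ℚ.<-irrefl refl }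
  ; trans = ℚ.<-trans
  ; <-resp-≈ = (λ { refl lt → lt }) , λ { refl lt → lt } })

-- Injectivity

PhiSet-<⇒≺ : ∀ (t : BTree n) {p} → PhiSet t p → ∀ i j → p i < p j → vT t i ≺ vT t j
PhiSet-<⇒≺ t φ i j pi<pj with ≺-total (vT t i) (vT t j)
... | inj₁ vi≺vj = vi≺vj
... | inj₂ (inj₁ vi≡vj) = ⊥-elim (ℚ.<-irrefl refl (ℚ.<-≤-trans pi<pj (proj₂ (proj₁ (φ j i)) (inj₂ (sym vi≡vj)))))
... | inj₂ (inj₂ vj≺vi) = ⊥-elim (ℚ.<-irrefl refl (ℚ.<-≤-trans pi<pj (proj₂ (proj₁ (φ j i)) (inj₁ vj≺vi))))

PhiSet-≺⇒< : ∀ (t : BTree n) {p} → PhiSet t p → ∀ i j → vT t i ≺ vT t j → p i < p j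
PhiSet-≺⇒< t φ i j vi≺vj = ℚ.≰⇒> λ pj≤pi → ≺-irrefl (≺-⪯-trans vi≺vj (proj₁ (proj₁ (φ j i)) pj≤pi))

-- The position of i in T′ is bounded below by its parent's, already known to be a node of T too.
vT′⪯vT : (T T′ : DecTree n) (p : Point n) → PhiSet (proj₁ T) p → PhiSet (proj₁ T′) p →
  ∀ i → (∀ j → p j < p i → vT (proj₁ T) j ≡ vT (proj₁ T′) j) → vT (proj₁ T′) i ⪯ vT (proj₁ T) i
vT′⪯vT T T′ p φ φ′ i ih = go (vT t′ i) refl
  where
    t = proj₁ T
    t′ = proj₁ T′
    parent : ∀ w x → vT t′ i ≡ w ∷ʳ x → w ≺ (w ∷ʳ x) → ∃ λ j → p j < p i × vT t j ≡ w × vT t′ j ≡ w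
    parent w x eq w≺ with LabelAt-init t′ w x (nonempty T′) (subst (λ v → LabelAt t′ v i) eq (vT-label T′ i))
    ... | j , at = j , pj<pi , trans (ih j pj<pi) (vT-unique T′ w at) , vT-unique T′ w at
      where
        pj<pi : p j < p i
        pj<pi = PhiSet-≺⇒< t′ φ′ j i (subst₂ _≺_ (sym (vT-unique T′ w at)) (sym eq) w≺)
    go : ∀ v → vT t′ i ≡ v → v ⪯ vT t i
    go v eq with initLast v
    ... | [] = []⪯ (vT t i)
    ... | w ∷ʳ′ false with parent w false eq (≺-∷ʳfalse w)
    -- The parent's coordinate is smaller, so in the other tree v_T(i) lies strictly after `w`,
    -- hence at or after w E₀.
    ... | j , pj<pi , vj≡w , _ = ∷ʳfalse-covers (subst (_≺ vT t i) vj≡w (PhiSet-<⇒≺ t φ j i pj<pi))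
    go v eq | w ∷ʳ′ true with parent w true eq (≺-∷ʳtrue w)
    -- If v_T(i) preceded w E₁, condition (2) would give pᵢ < pⱼ + 1 in T, and then in T′ would put
    -- v_T′(i) = w E₁ strictly before itself.
    ... | j , pj<pi , vj≡w , v′j≡w = ⊀⇒⪰ λ vi≺ → ≺-irrefl (subst (vT t′ i ≺_) (trans (cong (_∷ʳ true) v′j≡w) (sym eq))
            (proj₁ (proj₁ (proj₂ (φ′ i j))) (proj₂ (proj₁ (proj₂ (φ i j))) (subst (λ u → vT t i ≺ (u ∷ʳ true)) (sym vj≡w) vi≺))))

vT-determined : (T T′ : DecTree n) (p : Point n) → PhiSet (proj₁ T) p → PhiSet (proj₁ T′) p →
  ∀ i → vT (proj₁ T) i ≡ vT (proj₁ T′) i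
vT-determined T T′ p φ φ′ i = go i (wellFounded-by p i)
  where
    go : ∀ i → Acc (λ i j → p i < p j) i → vT (proj₁ T) i ≡ vT (proj₁ T′) i
    go i (acc rs) = ⪯-antisym (vT′⪯vT T′ T p φ′ φ i (λ j lt → sym (go j (rs lt)))) (vT′⪯vT T T′ p φ φ′ i (λ j lt → go j (rs lt)))

-- A dashed edge ends at a node, so it shows in the point as an equality pᵢ = pⱼ + 1, which
-- condition (3) for T′ turns back into a dashed edge.
DashAt-transfer : (T T′ : DecTree n) (p : Point n) → PhiSet (proj₁ T) p → PhiSet (proj₁ T′) p →
  ∀ w → DashAt (proj₁ T) w → DashAt (proj₁ T′) w
DashAt-transfer T T′ p φ φ′ w dash
  with DashAt⇒LabelAt (proj₁ T) w (dashOK T) (nonempty T) dash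
... | i , ati with LabelAt-init (proj₁ T) w true (nonempty T) ati
... | j , atj = subst (DashAt t′) (trans (sym (vT-determined T T′ p φ φ′ j)) vj≡w)
      (captive⇒DashAt t′ (proj₂ (proj₁ (proj₂ (proj₂ (φ′ i j))) pi≡pj+1)))
  where
    t = proj₁ T
    t′ = proj₁ T′
    vj≡w : vT t j ≡ w
    vj≡w = vT-unique T w atj
    pi≡pj+1 : p i ≡ p j + 1ℚ
    pi≡pj+1 = proj₂ (proj₂ (proj₂ (φ i j)))
      ( trans (vT-unique T _ ati) (cong (_∷ʳ true) (sym vj≡w))
      , subst (λ u → Captive t (u ∷ʳ true)) (sym vj≡w) (DashAt⇒captive t w (dashOK T) dash))

tree-determined : (T T′ : DecTree n) (p : Point n) → PhiSet (proj₁ T) p → PhiSet (proj₁ T′) p → proj₁ T ≡ proj₁ T′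
tree-determined T T′ p φ φ′ = tree-ext (proj₁ T) (proj₁ T′) (nonempty T) (nonempty T′)
    (label T T′ φ φ′) (label T′ T φ′ φ) (DashAt-transfer T T′ p φ φ′) (DashAt-transfer T′ T p φ′ φ)
  where
    label : ∀ T T′ → PhiSet (proj₁ T) p → PhiSet (proj₁ T′) p → ∀ w i → LabelAt (proj₁ T) w i → LabelAt (proj₁ T′) w i
    label T T′ φ φ′ w i at = subst (λ u → LabelAt (proj₁ T′) u i)
      (trans (sym (vT-determined T T′ p φ φ′ i)) (vT-unique T w at)) (vT-label T′ i)

-- Surjectivity

argmax : ∀ {n} {P : Fin n → Set} → Decidable P → (p : Fin n → ℚ) →
  (∀ j → ¬ P j) ⊎ (∃ λ j → P j × (∀ l → P l → p l ≤ p j))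
argmax {zero} P? p = inj₁ λ ()
argmax {suc n} P? p with argmax (λ j → P? (suc j)) (λ j → p (suc j)) | P? zero
... | inj₁ none | no ¬P0 = inj₁ λ { zero → ¬P0 ; (suc j) → none j }
... | inj₁ none | yes P0 = inj₂ (zero , P0 , λ { zero _ → ℚ.≤-refl ; (suc l) Pl → ⊥-elim (none l Pl) })
... | inj₂ (j , Pj , max) | no ¬P0 = inj₂ (suc j , Pj , λ { zero P0 → ⊥-elim (¬P0 P0) ; (suc l) Pl → max l Pl })
... | inj₂ (j , Pj , max) | yes P0 with ℚ.≤-total (p zero) (p (suc j))
... | inj₁ le = inj₂ (suc j , Pj , λ { zero _ → le ; (suc l) Pl → max l Pl })
... | inj₂ ge = inj₂ (zero , P0 , λ { zero _ → ℚ.≤-refl ; (suc l) Pl → ℚ.≤-trans (max l Pl) ge })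

upper-bound : ∀ {m} (f : Fin m → ℕ) → ∃ λ N → ∀ i → f i ℕ.< N
upper-bound {zero} f = 0 , λ ()
upper-bound {suc m} f with upper-bound (λ i → f (suc i))
... | N , f<N = suc (f zero) ℕ.⊔ N ,
  λ { zero → ℕ.m≤m⊔n _ N ; (suc i) → ℕ.≤-trans (f<N i) (ℕ.m≤n⊔m (suc (f zero)) N) }

module _ (p : Point n) where

  -- Constrains only indices with `p a ≤ x`, and leads from the point to the paths, the reverse of
  -- `Compatible`. The conclusion of `above` is weak because a coordinate beyond `p b + 1` may still
  -- sit at the right child of `b`, across a solid edge.
  record Layout (π : Fin n → Path) (x : ℚ) : Set where
    field
      mono   : ∀ a b → p a ≤ x → p b ≤ x → p a < p b → π a ≺ π b
      same   : ∀ a b → p a ≤ x → p b ≤ x → p a ≡ p b → π a ≡ π b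
      below  : ∀ a b → p a ≤ x → p b ≤ x → p a < p b + 1ℚ → π a ≺ (π b ∷ʳ true)
      above  : ∀ a b → p a ≤ x → p b ≤ x → p b + 1ℚ ≤ p a → (π b ∷ʳ true) ⪯ π a
      exact  : ∀ a b → p a ≤ x → p b ≤ x → p a ≡ p b + 1ℚ → π a ≡ π b ∷ʳ true
      closed : ∀ a u v → p a ≤ x → π a ≡ u ++ v → ∃ λ b → p b ≤ x × π b ≡ u
  open Layout

  private
    absurd-+1 : ∀ {A : Set} {a b} → p a ≤ p b → p b + 1ℚ ≤ p a → A
    absurd-+1 {a = a} {b} a≤b b+1≤a = ⊥-elim (ℚ.<-irrefl refl (ℚ.<-≤-trans (x<x+1 (p b)) (ℚ.≤-trans b+1≤a a≤b)))

  -- `p m` is the largest value below `p i`, so all indices with value `p i` are placed at `v`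
  -- together. What has to be checked about `v` is its comparison with the placed nodes and their
  -- right children, and that its parent is a placed node.
  module Extend {π₀ : Fin n → Path} {m i : Fin n} (L : Layout π₀ (p m)) (pm<pi : p m < p i)
    (prev : ∀ a → p a < p i → p a ≤ p m)
    (v : Path)
    (after : ∀ a → p a ≤ p m → π₀ a ≺ v)
    (above-v : ∀ a → p a ≤ p m → p a + 1ℚ ≤ p i → (π₀ a ∷ʳ true) ⪯ v)
    (exact-v : ∀ a → p a ≤ p m → p i ≡ p a + 1ℚ → v ≡ π₀ a ∷ʳ true)
    (below-v : ∀ a → p a ≤ p m → p i < p a + 1ℚ → v ≺ (π₀ a ∷ʳ true))
    (child : ∃ λ b → p b ≤ p m × ∃ λ x → v ≡ π₀ b ∷ʳ x)
    where

    π : Fin n → Path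
    π a with p a ℚ.<? p i
    ... | yes _ = π₀ a
    -- This includes the indices with `p a > p i`, on which a layout up to `p i` puts no condition.
    ... | no _ = v

    data View (a : Fin n) : Set where
      old : p a ≤ p m → p a < p i → π a ≡ π₀ a → View a
      new : p a ≡ p i → π a ≡ v → View a

    π-old : ∀ a → p a < p i → π a ≡ π₀ a
    π-old a lt with p a ℚ.<? p i
    ... | yes _ = refl
    ... | no ≮ = ⊥-elim (≮ lt)

    π-new : ∀ a → p a ≡ p i → π a ≡ v
    π-new a eq with p a ℚ.<? p i
    ... | yes lt = ⊥-elim (ℚ.<-irrefl eq lt)
    ... | no _ = refl

    view : ∀ a → p a ≤ p i → View a
    view a le with ℚ.<-cmp (p a) (p i)
    ... | tri< lt _ _ = old (prev a lt) lt (π-old a lt)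
    ... | tri≈ _ eq _ = new eq (π-new a eq)
    ... | tri> _ _ gt = ⊥-elim (ℚ.<-irrefl refl (ℚ.<-≤-trans gt le))

    layout : Layout π (p i)
    layout .mono a b a≤ b≤ a<b with view a a≤ | view b b≤
    ... | old a≤m _ ea | old b≤m _ eb = subst₂ _≺_ (sym ea) (sym eb) (L .mono a b a≤m b≤m a<b)
    ... | old a≤m _ ea | new _ eb = subst₂ _≺_ (sym ea) (sym eb) (after a a≤m)
    ... | new a≡ _ | _ = ⊥-elim (ℚ.<-irrefl a≡ (ℚ.<-≤-trans a<b b≤))
    layout .same a b a≤ b≤ a≡b with view a a≤ | view b b≤
    ... | old a≤m _ ea | old b≤m _ eb = trans ea (trans (L .same a b a≤m b≤m a≡b) (sym eb))
    ... | old _ a< _ | new b≡ _ = ⊥-elim (ℚ.<-irrefl (trans a≡b b≡) a<)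
    ... | new a≡ _ | old _ b< _ = ⊥-elim (ℚ.<-irrefl (trans (sym a≡b) a≡) b<)
    ... | new _ ea | new _ eb = trans ea (sym eb)
    layout .below a b a≤ b≤ a<b+1 with view a a≤ | view b b≤
    ... | old a≤m _ ea | old b≤m _ eb = subst₂ (λ u w → u ≺ (w ∷ʳ true)) (sym ea) (sym eb) (L .below a b a≤m b≤m a<b+1)
    ... | old a≤m _ ea | new _ eb = subst₂ (λ u w → u ≺ (w ∷ʳ true)) (sym ea) (sym eb) (≺-trans (after a a≤m) (≺-∷ʳtrue v))
    ... | new a≡ ea | old b≤m _ eb = subst₂ (λ u w → u ≺ (w ∷ʳ true)) (sym ea) (sym eb) (below-v b b≤m (subst (_< p b + 1ℚ) a≡ a<b+1))
    ... | new _ ea | new _ eb = subst₂ (λ u w → u ≺ (w ∷ʳ true)) (sym ea) (sym eb) (≺-∷ʳtrue v)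
    layout .above a b a≤ b≤ b+1≤a with view a a≤ | view b b≤
    ... | old a≤m _ ea | old b≤m _ eb = subst₂ (λ u w → (w ∷ʳ true) ⪯ u) (sym ea) (sym eb) (L .above a b a≤m b≤m b+1≤a)
    ... | _ | new b≡ _ = absurd-+1 (ℚ.≤-trans a≤ (ℚ.≤-reflexive (sym b≡))) b+1≤a
    ... | new a≡ ea | old b≤m _ eb = subst₂ (λ u w → (w ∷ʳ true) ⪯ u) (sym ea) (sym eb) (above-v b b≤m (subst (p b + 1ℚ ≤_) a≡ b+1≤a))
    layout .exact a b a≤ b≤ a≡b+1 with view a a≤ | view b b≤
    ... | old a≤m _ ea | old b≤m _ eb = trans ea (trans (L .exact a b a≤m b≤m a≡b+1) (cong (_∷ʳ true) (sym eb)))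
    ... | _ | new b≡ _ = absurd-+1 (ℚ.≤-trans a≤ (ℚ.≤-reflexive (sym b≡))) (ℚ.≤-reflexive (sym a≡b+1))
    ... | new a≡ ea | old b≤m _ eb = trans ea (trans (exact-v b b≤m (trans (sym a≡) a≡b+1)) (cong (_∷ʳ true) (sym eb)))
    layout .closed a u s a≤ πa≡ = go (view a a≤)
      where
        lift : ∃ (λ b → p b ≤ p m × π₀ b ≡ u) → ∃ λ b → p b ≤ p i × π b ≡ u
        lift (b , b≤m , eq) = b , ℚ.<⇒≤ b< , trans (π-old b b<) eq
          where b< = ℚ.≤-<-trans b≤m pm<pi
        go : View a → ∃ λ b → p b ≤ p i × π b ≡ u
        go (old a≤m _ ea) = lift (L .closed a u s a≤m (trans (sym ea) πa≡))
        -- A proper prefix of `v` is a prefix of its parent's path, and the parent is already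
        -- placed.
        go (new _ ea) with initLast s
        ... | [] = a , a≤ , trans πa≡ (++-identityʳ u)
        ... | s′ ∷ʳ′ y = let b , b≤m , x , v≡ = child in lift (L .closed b u s′ b≤m
                (∷ʳ-injectiveˡ (π₀ b) (u ++ s′) (trans (sym v≡) (trans (sym ea) (trans πa≡ (sym (++-assoc u s′ _)))))))

  -- The next node goes to the right child of the last j with pⱼ + 1 ≤ pᵢ if that vertex
  -- comes after every node placed so far, and else to the left child of the last of these.
  layout-step : ∀ {π₀ m i} → Layout π₀ (p m) → p m < p i → (∀ a → p a < p i → p a ≤ p m) → ∃ λ π → Layout π (p i)
  layout-step {π₀} {m} {i} L pm<pi prev = choose (argmax (λ j → (p j + 1ℚ) ℚ.≤? p i) p)
    where
      weakly-mono : ∀ a b → p a ≤ p m → p b ≤ p m → p a ≤ p b → π₀ a ⪯ π₀ b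
      weakly-mono a b a≤m b≤m a≤b with ℚ.<-cmp (p a) (p b)
      ... | tri< lt _ _ = inj₁ (L .mono a b a≤m b≤m lt)
      ... | tri≈ _ eq _ = inj₂ (L .same a b a≤m b≤m eq)
      ... | tri> _ _ gt = ⊥-elim (ℚ.<-irrefl refl (ℚ.<-≤-trans gt a≤b))

      ⪯m : ∀ a → p a ≤ p m → π₀ a ⪯ π₀ m
      ⪯m a a≤m = weakly-mono a m a≤m ℚ.≤-refl a≤m

      child-mono : ∀ a w → p a ≤ p m → p w ≤ p m → p a ≤ p w → (π₀ a ∷ʳ true) ⪯ (π₀ w ∷ʳ true)
      child-mono a w a≤m w≤m a≤w = ∷ʳtrue-mono-⪯ (weakly-mono a w a≤m w≤m a≤w)

      left : (∀ a → p a ≤ p m → p a + 1ℚ ≤ p i → (π₀ a ∷ʳ true) ⪯ π₀ m) → ∃ λ π → Layout π (p i)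
      left passed = _ , Extend.layout L pm<pi prev (π₀ m ∷ʳ false)
        (λ a a≤m → ⪯-≺-trans (⪯m a a≤m) (≺-∷ʳfalse _))
        (λ a a≤m a+1≤i → inj₁ (⪯-≺-trans (passed a a≤m a+1≤i) (≺-∷ʳfalse _)))
        -- Equality would give `p m < p a + 1`, so by `below` the node of `m` precedes the right
        -- child of `a`, which has been passed.
        (λ a a≤m i≡a+1 → ⊥-elim (≺-irrefl (⪯-≺-trans (passed a a≤m (ℚ.≤-reflexive (sym i≡a+1)))
          (L .below m a ℚ.≤-refl a≤m (subst (p m <_) i≡a+1 pm<pi)))))
        -- The covering property gives `⪯`, and the last letters differ.
        (λ a a≤m i<a+1 → not-right a (∷ʳfalse-covers (L .below m a ℚ.≤-refl a≤m (ℚ.<-trans pm<pi i<a+1))))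
        (m , ℚ.≤-refl , false , refl)
        where
          not-right : ∀ a → (π₀ m ∷ʳ false) ⪯ (π₀ a ∷ʳ true) → (π₀ m ∷ʳ false) ≺ (π₀ a ∷ʳ true)
          not-right a (inj₁ lt) = lt
          not-right a (inj₂ eq) with ∷ʳ-injectiveʳ (π₀ m) (π₀ a) eq
          ... | ()

      right : ∀ w → p w ≤ p m → p w + 1ℚ ≤ p i → (∀ a → p a + 1ℚ ≤ p i → p a ≤ p w) →
        π₀ m ≺ (π₀ w ∷ʳ true) → ∃ λ π → Layout π (p i)
      right w w≤m w+1≤i last m≺ = _ , Extend.layout L pm<pi prev (π₀ w ∷ʳ true)
        (λ a a≤m → ⪯-≺-trans (⪯m a a≤m) m≺)
        (λ a a≤m a+1≤i → child-mono a w a≤m w≤m (last a a+1≤i))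
        -- Such an `a` has the same value as `w`: at most `p w` by the choice of `w`, and at least
        -- `p w` since `p w + 1 ≤ p i`.
        (λ a a≤m i≡a+1 → cong (_∷ʳ true) (L .same w a w≤m a≤m
          (ℚ.≤-antisym (+1-cancel (subst (p w + 1ℚ ≤_) i≡a+1 w+1≤i)) (last a (ℚ.≤-reflexive (sym i≡a+1))))))
        (λ a a≤m i<a+1 → ∷ʳtrue-mono (L .mono w a w≤m a≤m (ℚ.≰⇒> λ a≤w →
          ℚ.<-irrefl refl (ℚ.<-≤-trans i<a+1 (ℚ.≤-trans (ℚ.+-monoˡ-≤ 1ℚ a≤w) w+1≤i)))))
        (w , w≤m , true , refl)
        where
          +1-cancel : ∀ {x y} → x + 1ℚ ≤ y + 1ℚ → x ≤ y
          +1-cancel le = ℚ.≮⇒≥ λ lt → ℚ.<-irrefl refl (ℚ.<-≤-trans (ℚ.+-monoˡ-< 1ℚ lt) le)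

      left-if-passed : ∀ w → p w ≤ p m → (∀ a → p a + 1ℚ ≤ p i → p a ≤ p w) →
        (π₀ w ∷ʳ true) ⪯ π₀ m → ∃ λ π → Layout π (p i)
      left-if-passed w w≤m last w1⪯m =
        left λ a a≤m a+1≤i → ⪯-trans (child-mono a w a≤m w≤m (last a a+1≤i)) w1⪯m

      choose : _ → ∃ λ π → Layout π (p i)
      choose (inj₁ none) = left λ a _ a+1≤i → ⊥-elim (none a a+1≤i)
      choose (inj₂ (w , w+1≤i , last)) with ≺-total (π₀ m) (π₀ w ∷ʳ true) | prev w (ℚ.<-≤-trans (x<x+1 (p w)) w+1≤i)
      ... | inj₁ m≺ | w≤m = right w w≤m w+1≤i last m≺
      ... | inj₂ (inj₁ m≡) | w≤m = left-if-passed w w≤m last (inj₂ (sym m≡))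
      ... | inj₂ (inj₂ ≺m) | w≤m = left-if-passed w w≤m last (inj₁ ≺m)

  layout-base : ∀ i → (∀ a → ¬ p a < p i) → Layout (λ _ → []) (p i)
  layout-base i min = record
    { mono = λ a b _ b≤ a<b → ⊥-elim (min a (ℚ.<-≤-trans a<b b≤))
    ; same = λ _ _ _ _ _ → refl
    ; below = λ _ _ _ _ _ → ≺-∷ʳtrue []
    ; above = λ a b a≤ _ b+1≤a → absurd-+1 (ℚ.≤-trans a≤ (ℚ.≮⇒≥ (min b))) b+1≤a
    ; exact = λ a b a≤ _ a≡b+1 → absurd-+1 (ℚ.≤-trans a≤ (ℚ.≮⇒≥ (min b))) (ℚ.≤-reflexive (sym a≡b+1))
    ; closed = λ { a [] v a≤ _ → a , a≤ , refl ; a (_ ∷ _) v _ () } }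

  layout-upto : ∀ i → Acc (λ i j → p i < p j) i → ∃ λ π → Layout π (p i)
  layout-upto i (acc rs) with argmax (λ j → p j ℚ.<? p i) p
  ... | inj₁ min = _ , layout-base i min
  ... | inj₂ (m , pm<pi , prev) = layout-step (proj₂ (layout-upto m (rs pm<pi))) pm<pi prev

  module FromLayout (π : Fin n → Path) (top : ℚ) (≤top : ∀ a → p a ≤ top) (L : Layout π top) where
    private
      N = proj₁ (upper-bound (λ i → length (π i)))

      -- The right edge at `w` is to be dashed when the coordinate placed at `w`, increased by 1, is
      -- again a coordinate; by `exact` that one sits at w E₁.
      exact-pair? : ∀ w → Dec (∃ λ a → ∃ λ b → π b ≡ w × p a ≡ p b + 1ℚ)
      exact-pair? w = any? λ a → any? λ b → ≡-dec Bool._≟_ (π b) w ×-dec (p a ℚ.≟ p b + 1ℚ)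

      δ : Path → Bool
      δ w = does (exact-pair? w)

      δ-true : ∀ w → δ w ≡ true → ∃ λ a → ∃ λ b → π b ≡ w × p a ≡ p b + 1ℚ
      δ-true w eq with exact-pair? w
      ... | yes pair = pair
      δ-true w () | no _

      valid : Valid N (λ i → just (π i)) δ
      valid .Valid.bounded i w refl = proj₂ (upper-bound (λ i → length (π i))) i
      valid .Valid.prefix-closed i u v eq with L .closed i u v (≤top i) (just-injective eq)
      ... | b , _ , eq′ = b , cong just eq′
      valid .Valid.dash-child w eq with δ-true w eq
      ... | a , b , refl , a≡b+1 = a , cong just (L .exact a b (≤top a) (≤top b) a≡b+1)

      t : BTree n
      t = treeOf N (λ i → just (π i)) δ

    tree : DecTree n
    tree = t , treeOf-dashOK N valid , nonemptyLabels⁻ t (treeOf-nonempty N valid) , treeOf-count N valid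

    private
      π≡ : ∀ i → vT t i ≡ π i
      π≡ i = vT-unique tree (π i) (treeOf-label⁺ N valid (π i) i refl)

      π1≡ : ∀ i → v1T t i ≡ π i ∷ʳ true
      π1≡ i = cong (_∷ʳ true) (π≡ i)

      π-injective : ∀ i j → π i ≡ π j → p i ≡ p j
      π-injective i j eq with ℚ.<-cmp (p i) (p j)
      ... | tri< lt _ _ = ⊥-elim (≺-irrefl (subst (_≺ π j) eq (L .mono i j (≤top i) (≤top j) lt)))
      ... | tri≈ _ p≡ _ = p≡
      ... | tri> _ _ gt = ⊥-elim (≺-irrefl (subst (π j ≺_) eq (L .mono j i (≤top j) (≤top i) gt)))

      lt-π : ∀ i j → π i ≺ π j → p i < p j
      lt-π i j πi≺πj with ℚ.<-cmp (p i) (p j)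
      ... | tri< lt _ _ = lt
      ... | tri≈ _ eq _ = ⊥-elim (≺-irrefl (subst (π i ≺_) (L .same j i (≤top j) (≤top i) (sym eq)) πi≺πj))
      ... | tri> _ _ gt = ⊥-elim (≺-asym πi≺πj (L .mono j i (≤top j) (≤top i) gt))

      compatible : ∀ i j → Compatible tree p i j
      compatible i j = record
        { lt = λ vi≺vj → lt-π i j (subst₂ _≺_ (π≡ i) (π≡ j) vi≺vj)
        ; eq = λ vi≡vj → π-injective i j (trans (sym (π≡ i)) (trans vi≡vj (π≡ j)))
        ; lt₁ = λ vi≺ → ℚ.≰⇒> λ le → ≺-irrefl
            (≺-⪯-trans (subst₂ _≺_ (π≡ i) (π1≡ j) vi≺) (L .above i j (≤top i) (≤top j) le))
        ; gt₁ = λ ≺vi → gt (inj₁ (subst₂ _≺_ (π1≡ j) (π≡ i) ≺vi))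
            λ pi≡ → ≺-irrefl (subst ((π j ∷ʳ true) ≺_) (L .exact i j (≤top i) (≤top j) pi≡) (subst₂ _≺_ (π1≡ j) (π≡ i) ≺vi))
        ; dash = λ vi≡ d → dash′ (trans (sym (π≡ i)) (trans vi≡ (π1≡ j))) (subst (DashAt t) (π≡ j) d)
        ; free = λ vi≡ ¬d → gt (inj₂ (sym (trans (sym (π≡ i)) (trans vi≡ (π1≡ j)))))
            λ pi≡ → ¬d (subst (DashAt t) (sym (π≡ j)) (treeOf-dash⁺ N valid (π j) j refl
              (dec-true (exact-pair? (π j)) (i , j , refl , pi≡)))) }
        where
          -- `below` excludes `<`. Equality is excluded by `exact` when `π i` lies strictly beyond
          -- the right child, and by the definition of `δ` when the edge is not dashed.
          gt : (π j ∷ʳ true) ⪯ π i → ¬ p i ≡ p j + 1ℚ → p j + 1ℚ < p i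
          gt ⪯πi ≢ with ℚ.<-cmp (p i) (p j + 1ℚ)
          ... | tri< lt _ _ = ⊥-elim (≺-irrefl (≺-⪯-trans (L .below i j (≤top i) (≤top j) lt) ⪯πi))
          ... | tri≈ _ eq _ = ⊥-elim (≢ eq)
          ... | tri> _ _ gt = gt
          dash′ : π i ≡ π j ∷ʳ true → DashAt t (π j) → p i ≡ p j + 1ℚ
          -- The pair that caused the dash may differ from `i`, `j` but occupies the same two nodes,
          -- so it has the same coordinates.
          dash′ πi≡ d with δ-true (π j) (treeOf-dash⁻ N (π j) d)
          ... | a , b , πb≡πj , pa≡ = trans
                (π-injective i a (trans πi≡ (trans (cong (_∷ʳ true) (sym πb≡πj)) (sym (L .exact a b (≤top a) (≤top b) pa≡)))))
                (trans pa≡ (cong (_+ 1ℚ) (π-injective b j πb≡πj)))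

    point∈PhiSet : PhiSet t p
    point∈PhiSet = compatible⇒PhiSet tree p compatible

  point-in-some-PhiSet : Fin n → Σ (DecTree n) λ T → PhiSet (proj₁ T) p
  point-in-some-PhiSet i₀ with argmax (λ _ → yes tt) p
  ... | inj₁ none = ⊥-elim (none i₀ tt)
  ... | inj₂ (i , _ , max) with layout-upto i (wellFounded-by p i)
  ... | π , L = tree , point∈PhiSet
    where open FromLayout π (p i) (λ a → max a tt) L

-- Dimension

-- The flag says whether the root is captive.
freePaths : Bool → BTree n → List Path
freePaths c leaf = []
freePaths c (node S l d r) =
  (if c then [] else [] ∷ []) ++ (map (false ∷_) (freePaths false l) ++ map (true ∷_) (freePaths d r))

length-freePaths : ∀ c (t : BTree n) → length (freePaths c t) ≡ freeNodes' c t
length-freePaths c leaf = refl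
length-freePaths c (node S l d r) = trans (root c _) (cong ((if c then 0 else 1) ℕ.+_)
  (trans (length-++ (map (false ∷_) (freePaths false l))) (cong₂ ℕ._+_
    (trans (length-map _ (freePaths false l)) (length-freePaths false l))
    (trans (length-map _ (freePaths d r)) (length-freePaths d r)))))
  where
    root : ∀ c (xs : List Path) → length ((if c then [] else [] ∷ []) ++ xs) ≡ (if c then 0 else 1) ℕ.+ length xs
    root false xs = refl
    root true xs = refl

data FreePath {n} (l : BTree n) (d : Bool) (r : BTree n) : Bool → Path → Set where
  root  : FreePath l d r false []
  left  : ∀ {c u} → u ∈ freePaths false l → FreePath l d r c (false ∷ u)
  right : ∀ {c u} → u ∈ freePaths d r → FreePath l d r c (true ∷ u)

freePath⁻ : ∀ S (l : BTree n) d r c {u} → u ∈ freePaths c (node S l d r) → FreePath l d r c u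
freePath⁻ S l d r c mem = go c mem
  where
    inner : ∀ {c u} → u ∈ map (false ∷_) (freePaths false l) ++ map (true ∷_) (freePaths d r) → FreePath l d r c u
    inner mem with ∈-++⁻ (map (false ∷_) (freePaths false l)) mem
    ... | inj₁ meml with ∈-map⁻ (false ∷_) meml
    ... | _ , mem′ , refl = left mem′
    inner mem | inj₂ memr with ∈-map⁻ (true ∷_) memr
    ... | _ , mem′ , refl = right mem′
    go : ∀ c {u} → u ∈ freePaths c (node S l d r) → FreePath l d r c u
    go true mem = inner mem
    go false (here refl) = root
    go false (there mem) = inner mem

freePath⁺ : ∀ S (l : BTree n) d r c {u} → FreePath l d r c u → u ∈ freePaths c (node S l d r)
freePath⁺ S l d r false root = here refl
freePath⁺ S l d r c (left mem) = ∈-++⁺ʳ (if c then [] else [] ∷ []) (∈-++⁺ˡ (∈-map⁺ (false ∷_) mem))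
freePath⁺ S l d r c (right mem) =
  ∈-++⁺ʳ (if c then [] else [] ∷ []) (∈-++⁺ʳ (map (false ∷_) (freePaths false l)) (∈-map⁺ (true ∷_) mem))

[]∉freePaths-true : ∀ (t : BTree n) → ¬ [] ∈ freePaths true t
[]∉freePaths-true (node S l d r) mem with freePath⁻ S l d r true mem
... | ()

freePaths-unique : ∀ c (t : BTree n) → Unique (freePaths c t)
freePaths-unique c leaf = []
freePaths-unique c (node S l d r) = go c
  where
    inner : Unique (map (false ∷_) (freePaths false l) ++ map (true ∷_) (freePaths d r))
    inner = Unique.++⁺ (Unique.map⁺ ∷-injectiveʳ (freePaths-unique false l))
      (Unique.map⁺ ∷-injectiveʳ (freePaths-unique d r)) disjoint
      where
        disjoint : ∀ {u} → ¬ (u ∈ map (false ∷_) (freePaths false l) × u ∈ map (true ∷_) (freePaths d r))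
        disjoint (meml , memr) with ∈-map⁻ (false ∷_) meml | ∈-map⁻ (true ∷_) memr
        ... | _ , _ , refl | _ , _ , ()
    go : ∀ c → Unique (freePaths c (node S l d r))
    go true = inner
    go false = All.++⁺ (All.map⁺ (All.universal (λ _ ()) (freePaths false l)))
      (All.map⁺ (All.universal (λ _ ()) (freePaths d r))) ∷ inner

freePaths-label : ∀ c (t : BTree n) {u} → NonemptyLabels t → u ∈ freePaths c t → ∃ λ i → LabelAt t u i
freePaths-label c (node S l d r) (rootlabel , nl , nr) mem with freePath⁻ S l d r c mem
... | root = rootlabel
... | left mem′ = freePaths-label false l nl mem′
... | right mem′ = freePaths-label d r nr mem′

-- A chain that reaches the root of the right subtree continues to the parent if the edge between
-- them is dashed; in every other case the path just gets E₁ in front.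
through : Bool → Path → Path
through true [] = []
through true (x ∷ u) = true ∷ x ∷ u
through false u = true ∷ u

-- The free node at the top of the chain of dashed edges through w.
captor : BTree n → Path → Path
captor leaf w = w
captor (node S l d r) [] = []
captor (node S l d r) (false ∷ w) = false ∷ captor l w
captor (node S l d r) (true ∷ w) = through d (captor r w)

captor-[] : (t : BTree n) → captor t [] ≡ []
captor-[] leaf = refl
captor-[] (node S l d r) = refl

captor-dash : ∀ (t : BTree n) w → DashAt t w → captor t (w ∷ʳ true) ≡ captor t w
captor-dash (node S l d r) [] refl rewrite captor-[] r = refl
captor-dash (node S l d r) (false ∷ w) dash = cong (false ∷_) (captor-dash l w dash)
captor-dash (node S l d r) (true ∷ w) dash = cong (through d) (captor-dash r w dash)

captor-free : ∀ c (t : BTree n) {u} → u ∈ freePaths c t → captor t u ≡ u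
captor-free c (node S l d r) mem with freePath⁻ S l d r c mem
... | root = refl
... | left mem′ = cong (false ∷_) (captor-free false l mem′)
captor-free c (node S l false r) mem | right mem′ = cong (true ∷_) (captor-free false r mem′)
captor-free c (node S l true r) mem | right {u = []} mem′ = ⊥-elim ([]∉freePaths-true r mem′)
captor-free c (node S l true r) mem | right {u = x ∷ u} mem′ rewrite captor-free true r mem′ = refl

-- If the root of a subtree is captive, a chain may run up to it without meeting a free node there;
-- this is the second alternative, and `c = false` rules it out for the whole tree.
captor∈ : ∀ c (t : BTree n) w {i} → LabelAt t w i →
  captor t w ∈ freePaths c t ⊎ (c ≡ true × captor t w ≡ [])
captor∈ false (node S l d r) [] at = inj₁ (here refl)
captor∈ true (node S l d r) [] at = inj₂ (refl , refl)
captor∈ c (node S l d r) (false ∷ w) at with captor∈ false l w at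
... | inj₁ mem = inj₁ (freePath⁺ S l d r c (left mem))
... | inj₂ (() , _)
captor∈ c (node S l d r) (true ∷ w) at with captor∈ d r w at
captor∈ c (node S l false r) (true ∷ w) at | inj₁ mem = inj₁ (freePath⁺ S l false r c (right mem))
captor∈ c (node S l true r) (true ∷ w) at | inj₁ mem with captor r w
... | [] = ⊥-elim ([]∉freePaths-true r mem)
... | x ∷ u = inj₁ (freePath⁺ S l true r c (right mem))
captor∈ false (node S l true r) (true ∷ w) at | inj₂ (_ , eq) rewrite eq = inj₁ (here refl)
captor∈ true (node S l true r) (true ∷ w) at | inj₂ (_ , eq) rewrite eq = inj₂ (refl , refl)

-- Induction along the chain of dashed edges. `R` is arbitrary because descending an edge replaces
-- it by its restriction to paths that start with that edge.
captor-related : ∀ (t : BTree n) (R : Path → Path → Set) → (∀ {w} → R w w) → (∀ {u v w} → R u v → R v w → R u w) →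
  (∀ w → DashAt t w → R (w ∷ʳ true) w) → ∀ w → R w (captor t w)
captor-related leaf R R-refl R-trans R-dash w = R-refl
captor-related (node S l d r) R R-refl R-trans R-dash [] = R-refl
captor-related (node S l d r) R R-refl R-trans R-dash (false ∷ w) =
  captor-related l (λ u v → R (false ∷ u) (false ∷ v)) R-refl R-trans (λ w → R-dash (false ∷ w)) w
captor-related (node S l d r) R R-refl R-trans R-dash (true ∷ w)
  with d | captor r w | R-dash [] | captor-related r (λ u v → R (true ∷ u) (true ∷ v)) R-refl R-trans (λ w → R-dash (true ∷ w)) w
... | false | _ | _ | rel = rel
... | true | [] | up | rel = R-trans rel (up refl)
... | true | _ ∷ _ | _ | rel = rel

solidEdges : BTree n → Path → ℚ
solidEdges leaf _ = 0ℚ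
solidEdges (node S l d r) [] = 0ℚ
solidEdges (node S l d r) (false ∷ w) = solidEdges l w
solidEdges (node S l d r) (true ∷ w) = solidEdges r w + (if d then 0ℚ else 1ℚ)

solidEdges-[] : (t : BTree n) → solidEdges t [] ≡ 0ℚ
solidEdges-[] leaf = refl
solidEdges-[] (node S l d r) = refl

solidEdges-dash : ∀ (t : BTree n) w → DashAt t w → solidEdges t (w ∷ʳ true) ≡ solidEdges t w
solidEdges-dash (node S l d r) [] refl rewrite solidEdges-[] r = refl
solidEdges-dash (node S l d r) (false ∷ w) dash = solidEdges-dash l w dash
solidEdges-dash (node S l d r) (true ∷ w) dash = cong (_+ _) (solidEdges-dash r w dash)

-- `LabelAt` places `w` at a node; from a leaf on the count stays 0.
solidEdges-solid : ∀ (t : BTree n) w {i} → LabelAt t w i → ¬ DashAt t w → solidEdges t (w ∷ʳ true) ≡ solidEdges t w + 1ℚ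
solidEdges-solid (node S l true r) [] at ¬dash = ⊥-elim (¬dash refl)
solidEdges-solid (node S l false r) [] at ¬dash rewrite solidEdges-[] r = refl
solidEdges-solid (node S l d r) (false ∷ w) at ¬dash = solidEdges-solid l w at ¬dash
solidEdges-solid (node S l d r) (true ∷ w) at ¬dash =
  trans (cong (_+ e) (solidEdges-solid r w at ¬dash))
    (solve 3 (λ a b c → (a :+ b) :+ c := (a :+ c) :+ b) refl (solidEdges r w) 1ℚ e)
  where e = if d then 0ℚ else 1ℚ

lookup-injective : ∀ {A : Set} {xs : List A} → Unique xs → ∀ i j → List.lookup xs i ≡ List.lookup xs j → i ≡ j
lookup-injective (_ ∷ _) zero zero _ = refl
lookup-injective {xs = _ ∷ xs} (x∉ ∷ _) zero (suc j) eq = ⊥-elim (All.lookup x∉ (∈-lookup {xs = xs} j) eq)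
lookup-injective {xs = _ ∷ xs} (x∉ ∷ _) (suc i) zero eq = ⊥-elim (All.lookup x∉ (∈-lookup {xs = xs} i) (sym eq))
lookup-injective (_ ∷ u) (suc i) (suc j) eq = cong suc (lookup-injective u i j eq)

-- The part `h + e * s` is common to all points and is killed by `sumQ c ≡ 0ℚ`; of the rest only the
-- term at `b` remains.
isolate-coefficient : ∀ {m} (c ι : Fin m → ℚ) b → ι b ≡ 1ℚ → (∀ a → a ≢ b → ι a ≡ 0ℚ) → ∀ h s e →
  sumQ c ≡ 0ℚ → sumQ (λ a → c a * (h + e * (s + ι a))) ≡ 0ℚ → c b * e ≡ 0ℚ
isolate-coefficient c ι b ι-self ι-other h s e Σc≡0 Σ≡0 = begin
  c b * e
    ≡⟨ cong (_* e) (sym (trans (cong (c b *_) ι-self) (ℚ.*-identityʳ (c b)))) ⟩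
  c b * ι b * e
    ≡⟨ cong (_* e) (sym (sum-single (λ a → c a * ι a) b (λ a a≢b → trans (cong (c a *_) (ι-other a a≢b)) (ℚ.*-zeroʳ (c a))))) ⟩
  sumQ (λ a → c a * ι a) * e
    ≡⟨ sym (ℚ.+-identityˡ (sumQ (λ a → c a * ι a) * e)) ⟩
  0ℚ + sumQ (λ a → c a * ι a) * e
    ≡⟨ cong₂ _+_ (sym (trans (cong (_* base) Σc≡0) (ℚ.*-zeroˡ base))) (sym (sum-*ʳ (λ a → c a * ι a) e)) ⟩
  sumQ c * base + sumQ (λ a → c a * ι a * e)
    ≡⟨ cong (_+ sumQ (λ a → c a * ι a * e)) (sym (sum-*ʳ c base)) ⟩
  sumQ (λ a → c a * base) + sumQ (λ a → c a * ι a * e)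
    ≡⟨ sym (sum-+ (λ a → c a * base) (λ a → c a * ι a * e)) ⟩
  sumQ (λ a → c a * base + c a * ι a * e)
    ≡⟨ sum-cong (λ a → solve 5 (λ c h s i e → c :* (h :+ e :* s) :+ c :* i :* e := c :* (h :+ e :* (s :+ i)))
         refl (c a) h s (ι a) e) ⟩
  sumQ (λ a → c a * (h + e * (s + ι a)))
    ≡⟨ Σ≡0 ⟩
  0ℚ ∎
  where
    open ≡-Reasoning
    base = h + e * s

-- The two bounds on the dimension

module Dimension (T : DecTree n) where
  private
    t = proj₁ T
    fs = freePaths false t
    k = length fs

    _≟P_ : (u v : Path) → Dec (u ≡ v)
    _≟P_ = ≡-dec Bool._≟_

  indicator : Fin (suc k) → Path → ℚ
  indicator zero u = 0ℚ
  indicator (suc b) u = if does (u ≟P List.lookup fs b) then 1ℚ else 0ℚ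

  indicator≥0 : ∀ a u → 0ℚ ≤ indicator a u
  indicator≥0 zero u = ℚ.≤-refl
  indicator≥0 (suc b) u with does (u ≟P List.lookup fs b)
  ... | true = ℚ.<⇒≤ 0<1
  ... | false = ℚ.≤-refl

  indicator≤1 : ∀ a u → indicator a u ≤ 1ℚ
  indicator≤1 zero u = ℚ.<⇒≤ 0<1
  indicator≤1 (suc b) u with does (u ≟P List.lookup fs b)
  ... | true = ℚ.≤-refl
  ... | false = ℚ.<⇒≤ 0<1

  indicator-self : ∀ b → indicator (suc b) (List.lookup fs b) ≡ 1ℚ
  indicator-self b with List.lookup fs b ≟P List.lookup fs b
  ... | yes _ = refl
  ... | no ≢ = ⊥-elim (≢ refl)

  indicator-other : ∀ a b → a ≢ suc b → indicator a (List.lookup fs b) ≡ 0ℚ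
  indicator-other zero b _ = refl
  indicator-other (suc a) b a≢b with List.lookup fs b ≟P List.lookup fs a
  ... | yes eq = ⊥-elim (a≢b (cong suc (sym (lookup-injective (freePaths-unique false t) b a eq))))
  ... | no _ = refl

  -- Doubling makes the count gain 2 along a solid right edge, more than the indicator can lose
  -- there. Index `zero` is the base weight; index `suc b` adds 1 on the dashed chain below the free
  -- node `b`.
  weight : Fin (suc k) → Fin n → ℚ
  weight a i = (solidEdges t (vT t i) + solidEdges t (vT t i)) + indicator a (captor t (vT t i))

  weight-ok : ∀ a → Weight T (weight a)
  weight-ok a = record
    { same-node = λ i j eq → cong W eq
    ; dashed = λ i j eq d → trans (cong W eq)
        (cong₂ (λ x u → (x + x) + indicator a u) (solidEdges-dash t (vT t j) d) (captor-dash t (vT t j) d))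
    ; solid = λ i j eq ¬d → solid i j eq ¬d }
    where
      W : Path → ℚ
      W w = (solidEdges t w + solidEdges t w) + indicator a (captor t w)
      solid : ∀ i j → vT t i ≡ v1T t j → ¬ DashAt t (vT t j) → weight a j < weight a i
      solid i j eq ¬d = subst (W (vT t j) <_) (sym (cong W eq)) (begin-strict
        (s + s) + indicator a (captor t (vT t j))   ≤⟨ ℚ.+-monoʳ-≤ (s + s) (indicator≤1 a _) ⟩
        (s + s) + 1ℚ                                <⟨ ℚ.+-monoʳ-< (s + s) (subst (_< 1ℚ + 1ℚ) (ℚ.+-identityʳ 1ℚ) (ℚ.+-monoʳ-< 1ℚ 0<1)) ⟩
        (s + s) + (1ℚ + 1ℚ)                         ≡⟨ solve 2 (λ s o → (s :+ s) :+ (o :+ o) := (s :+ o) :+ (s :+ o)) refl s 1ℚ ⟩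
        (s + 1ℚ) + (s + 1ℚ)                         ≡⟨ cong (λ x → x + x) (sym (solidEdges-solid t (vT t j) (vT-label T j) ¬d)) ⟩
        s′ + s′                                     ≡⟨ sym (ℚ.+-identityʳ (s′ + s′)) ⟩
        (s′ + s′) + 0ℚ                              ≤⟨ ℚ.+-monoʳ-≤ (s′ + s′) (indicator≥0 a _) ⟩
        (s′ + s′) + indicator a (captor t (v1T t j)) ∎)
        where
          open ℚ.≤-Reasoning
          s = solidEdges t (vT t j)
          s′ = solidEdges t (v1T t j)

  rep : Fin k → Fin n
  rep b = proj₁ (freePaths-label false t (nonempty T) (∈-lookup b))

  vT-rep : ∀ b → vT t (rep b) ≡ List.lookup fs b
  vT-rep b = vT-unique T _ (proj₂ (freePaths-label false t (nonempty T) (∈-lookup b)))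

  captor-rep : ∀ b → captor t (vT t (rep b)) ≡ List.lookup fs b
  captor-rep b = trans (cong (captor t) (vT-rep b)) (captor-free false t (∈-lookup b))

  ε : ℚ
  ε = proj₁ (perturbed∈PhiSet T weight weight-ok)

  ε>0 : 0ℚ < ε
  ε>0 = proj₁ (proj₂ (perturbed∈PhiSet T weight weight-ok))

  q : Fin (suc k) → Point n
  q a = perturbed T (weight a) ε

  q∈PhiSet : ∀ a → PhiSet t (q a)
  q∈PhiSet = proj₂ (proj₂ (perturbed∈PhiSet T weight weight-ok))

  PhiSet-point : ∃ (PhiSet t)
  PhiSet-point = q zero , q∈PhiSet zero

  dim≥ : HasAffIndep (PhiSet t) k
  dim≥ = q , q∈PhiSet , indep
    where
      indep : AffIndep q
      indep c Σc≡0 Σcq≡0 = λ { zero → c₀≡0 ; (suc b) → c≡0 b }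
        where
          c≡0 : ∀ b → c (suc b) ≡ 0ℚ
          c≡0 b = decidable-stable (c (suc b) ℚ.≟ 0ℚ) λ c≢0 → *-≢0 c≢0 (λ ε≡0 → ℚ.<-irrefl (sym ε≡0) ε>0)
            -- At the coordinate `rep b` the points differ only in the indicator. A free node is its
            -- own captor, so the indicator is 1 for the point `suc b` and 0 for all others.
            (isolate-coefficient c ι (suc b) ι-self ι-other h s ε Σc≡0 (Σcq≡0 (rep b)))
            where
              h = height (vT t (rep b))
              s = solidEdges t (vT t (rep b)) + solidEdges t (vT t (rep b))
              ι : Fin (suc k) → ℚ
              ι a = indicator a (captor t (vT t (rep b)))
              ι-self : ι (suc b) ≡ 1ℚ
              ι-self = trans (cong (indicator (suc b)) (captor-rep b)) (indicator-self b)
              ι-other : ∀ a → a ≢ suc b → ι a ≡ 0ℚ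
              ι-other a a≢ = trans (cong (indicator a) (captor-rep b)) (indicator-other a b a≢)
          c₀≡0 : c zero ≡ 0ℚ
          c₀≡0 = trans (sym (sum-single c zero (λ { zero ≢ → ⊥-elim (≢ refl) ; (suc b) _ → c≡0 b }))) Σc≡0

  -- Each dashed edge on the chain from the captor down to the node of `x` adds exactly 1. Both `b`
  -- and `κ` are chosen before `q`, so one affine formula holds for all points of Φ(T).
  rigid : ∀ x → ∃ λ b → ∃ λ κ → ∀ q → PhiSet t q → q x ≡ q (rep b) + κ
  rigid x with captor∈ false t (vT t x) (vT-label T x)
  ... | inj₂ (() , _)
  ... | inj₁ mem with captor-related t R R-refl R-trans R-dash (vT t x)
    where
      R : Path → Path → Set
      R w w′ = ∃ λ κ → ∀ q → PhiSet t q → ∀ i → vT t i ≡ w → ∃ λ j → vT t j ≡ w′ × q i ≡ q j + κ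
      R-refl : ∀ {w} → R w w
      R-refl = 0ℚ , λ q φ i eq → i , eq , sym (ℚ.+-identityʳ (q i))
      R-trans : ∀ {u v w} → R u v → R v w → R u w
      R-trans (κ , f) (μ , g) = μ + κ , λ q φ i eq →
        let j , eqj , qi≡ = f q φ i eq
            l , eql , qj≡ = g q φ j eqj
        in l , eql , trans qi≡ (trans (cong (_+ κ) qj≡) (ℚ.+-assoc (q l) μ κ))
      R-dash : ∀ w → DashAt t w → R (w ∷ʳ true) w
      R-dash w d = 1ℚ , λ q φ i eq →
        let j , at = LabelAt-init t w true (nonempty T) (subst (λ u → LabelAt t u i) eq (vT-label T i))
            vj≡w = vT-unique T w at
        in j , vj≡w , proj₂ (proj₂ (proj₂ (φ i j)))
             ( trans eq (cong (_∷ʳ true) (sym vj≡w))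
             , subst (λ u → Captive t (u ∷ʳ true)) (sym vj≡w) (DashAt⇒captive t w (dashOK T) d))
  ... | κ , f = b , κ , λ q φ →
        let j , vj≡ , qx≡ = f q φ x refl
            v≡ = trans vj≡ (trans (lookup-index mem) (sym (vT-rep b)))
        in trans qx≡ (cong (_+ κ) (ℚ.≤-antisym (proj₂ (proj₁ (φ j (rep b))) (inj₂ v≡)) (proj₂ (proj₁ (φ (rep b) j)) (inj₂ (sym v≡)))))
    where b = Any.index mem

  dim≤ : ¬ HasAffIndep (PhiSet t) (suc k)
  dim≤ (q , φ , indep) = c≢0 (indep c Σc≡0 Σcq≡0 a₀)
    where
      M : Fin (suc (suc k)) → Fin (suc k) → ℚ
      -- The constant column makes the coefficients of the dependence sum to zero. With the `k` free
      -- coordinates there are `k + 1` columns for `k + 2` points.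
      M a zero = 1ℚ
      M a (suc b) = q a (rep b)
      dep = dependent M
      c = proj₁ dep
      a₀ = proj₁ (proj₂ (proj₂ dep))
      c≢0 = proj₂ (proj₂ (proj₂ dep))
      Σc≡0 : sumQ c ≡ 0ℚ
      Σc≡0 = trans (sum-cong (λ a → sym (ℚ.*-identityʳ (c a)))) (proj₁ (proj₂ dep) zero)
      Σcq≡0 : ∀ x → sumQ (λ a → c a * q a x) ≡ 0ℚ
      Σcq≡0 x with rigid x
      ... | b , κ , qx≡ = begin
        sumQ (λ a → c a * q a x)
          ≡⟨ sum-cong (λ a → trans (cong (c a *_) (qx≡ (q a) (φ a))) (ℚ.*-distribˡ-+ (c a) (q a (rep b)) κ)) ⟩
        sumQ (λ a → c a * q a (rep b) + c a * κ)
          ≡⟨ sum-+ (λ a → c a * q a (rep b)) (λ a → c a * κ) ⟩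
        sumQ (λ a → c a * q a (rep b)) + sumQ (λ a → c a * κ)
          ≡⟨ cong₂ _+_ (proj₁ (proj₂ dep) (suc b)) (trans (sum-*ʳ c κ) (trans (cong (_* κ) Σc≡0) (ℚ.*-zeroˡ κ))) ⟩
        0ℚ + 0ℚ ≡⟨ ℚ.+-identityˡ 0ℚ ⟩
        0ℚ ∎
        where open ≡-Reasoning

  PhiSet-dim : HasDim (PhiSet t) (freeNodes t)
  PhiSet-dim = subst (HasDim (PhiSet t)) (length-freePaths false t) (dim≥ , dim≤)

-- Uniqueness of the dimension

HasAffIndep-pred : ∀ (F : PointSet n) {m} → HasAffIndep F (suc m) → HasAffIndep F m
HasAffIndep-pred F {m} (q , q∈F , indep) = (λ a → q (suc a)) , (λ a → q∈F (suc a)) , λ c Σc≡0 Σcq≡0 a →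
  let c′ : Fin (suc (suc m)) → ℚ
      c′ = λ { zero → 0ℚ ; (suc a) → c a }
  in indep c′ (trans (ℚ.+-identityˡ _) Σc≡0)
       (λ x → trans (cong₂ _+_ (ℚ.*-zeroˡ (q zero x)) (Σcq≡0 x)) (ℚ.+-identityˡ 0ℚ)) (suc a)

HasAffIndep-≤ : ∀ (F : PointSet n) {m m′} → m ℕ.≤′ m′ → HasAffIndep F m′ → HasAffIndep F m
HasAffIndep-≤ F ℕ.≤′-refl h = h
HasAffIndep-≤ F (ℕ.≤′-step le) h = HasAffIndep-≤ F le (HasAffIndep-pred F h)

-- `HasDim F k` speaks of families of `k + 1` and `k + 2` points only; discarding points from a
-- larger independent family brings it down to the excluded size.
HasDim-unique : ∀ (F : PointSet n) {k l} → HasDim F k → HasDim F l → k ≡ l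
HasDim-unique F {k} {l} (hk , ¬k) (hl , ¬l) with ℕ.<-cmp k l
... | tri< k<l _ _ = ⊥-elim (¬k (HasAffIndep-≤ F (ℕ.≤⇒≤′ k<l) hl))
... | tri≈ _ k≡l _ = k≡l
... | tri> _ _ l<k = ⊥-elim (¬l (HasAffIndep-≤ F (ℕ.≤⇒≤′ l<k) hk))

theorem2p5 : (n : ℕ) → 1 ℕ.≤ n →
    ((T : DecTree n) → IsFace (PhiSet (proj₁ T)))
    × ((T T' : DecTree n) → PhiSet (proj₁ T) ≐ PhiSet (proj₁ T') → proj₁ T ≡ proj₁ T')
    × ((F : PointSet n) → IsFace F → Σ (DecTree n) λ T → F ≐ PhiSet (proj₁ T))
    × ((T : DecTree n) (k : ℕ) →
    (freeNodes (proj₁ T) ≡ k → HasDim (PhiSet (proj₁ T)) k)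
    × (HasDim (PhiSet (proj₁ T)) k → freeNodes (proj₁ T) ≡ k))
theorem2p5 (suc n) _ =
    (λ T → let p , φ = Dimension.PhiSet-point T in PhiSet-isFace (proj₁ T) p φ)
  , (λ T T′ Φ≐Φ′ → let p , φ = Dimension.PhiSet-point T in tree-determined T T′ p φ (proj₁ (Φ≐Φ′ p) φ))
  , (λ F face → let T , φ = point-in-some-PhiSet (proj₁ (proj₁ (proj₂ face))) zero in T , face≐PhiSet (proj₁ T) face φ)
  , λ T k → (λ { refl → Dimension.PhiSet-dim T }) , HasDim-unique (PhiSet (proj₁ T)) (Dimension.PhiSet-dim T)
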